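{- Let $p<q<r$ be odd primes and let $\Psi_{pqr}(x)=(x^{pqr}-1)/\Phi_{pqr}(x)$. If $h(\Psi_{pqr}(x))=p-1$, then either $q\equiv r\equiv 1\pmod p$ or $q\equiv r\equiv -1\pmod p$, and moreover $$r<\frac{(p-1)}{(p-2)}(q-1).$$
   Context: $\Phi_n(x)$ denotes the $n$-th cyclotomic polynomial and $\Psi_n(x)=(x^n-1)/\Phi_n(x)\in\mathbb Z[x]$. The height $h(f)$ of $f\in\mathbb Z[x]$ is the maximum absolute value of its coefficients. -}

module Defs where

open import Data.Nat as ℕ using (ℕ; zero; suc; _⊔_)
open import Data.Nat.Divisibility using (_∣?_)
open import Data.Integer as ℤ using (ℤ; +_; ∣_∣)
open import Data.List using (List; []; _∷_; map; foldr; filter; upTo; replicate)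
open import Relation.Binary.PropositionalEquality using (_≡_)

-- Polynomials over ℤ as coefficient lists, constant term first.
-- Trailing zeros are allowed; equality is coefficientwise (_≈ₚ_).
Poly : Set
Poly = List ℤ

coeff : Poly → ℕ → ℤ
coeff []       _       = + 0
coeff (a ∷ f)  zero    = a
coeff (a ∷ f)  (suc k) = coeff f k

_≈ₚ_ : Poly → Poly → Set
f ≈ₚ g = ∀ k → coeff f k ≡ coeff g k

infix 4 _≈ₚ_
infixl 6 _+ₚ_
infixl 7 _*ₚ_

_+ₚ_ : Poly → Poly → Poly
[]      +ₚ g       = g
f       +ₚ []      = f
(a ∷ f) +ₚ (b ∷ g) = (a ℤ.+ b) ∷ (f +ₚ g)

scale : ℤ → Poly → Poly
scale c = map (c ℤ.*_)

_*ₚ_ : Poly → Poly → Poly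
[]      *ₚ g = []
(a ∷ f) *ₚ g = scale a g +ₚ (+ 0 ∷ (f *ₚ g))

oneₚ : Poly
oneₚ = + 1 ∷ []

productₚ : List Poly → Poly
productₚ = foldr _*ₚ_ oneₚ

xpow-1 : ℕ → Poly
xpow-1 n = ℤ.-[1+ 0 ] ∷ (replicate (ℕ.pred n) (+ 0) Data.List.++ (+ 1 ∷ []))
  where import Data.List

divisors : ℕ → List ℕ
divisors n = filter (_∣? n) (map suc (upTo n))

-- Φ is the family of cyclotomic polynomials: x^n - 1 = ∏_{d ∣ n} Φ_d for all n ≥ 1
-- (this determines Φ_n uniquely for every n ≥ 1, by induction on n).
IsCyclotomic : (ℕ → Poly) → Set
IsCyclotomic Φ = ∀ n → 1 ℕ.≤ n → productₚ (map Φ (divisors n)) ≈ₚ xpow-1 n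

height : Poly → ℕ
height = foldr (λ a m → ∣ a ∣ ⊔ m) 0

{-# OPTIONS --safe #-}
module Submission where

-- Ψ_pqr(x) = Ψ_pq(x^r) Φ_pq(x) with Ψ_pq = (x^q - 1)(1 + x + ⋯ + x^(p-1)), so a coefficient of Ψ_pqr
-- is a signed sum of coefficients of Φ_pq at exponents spaced by r.  These exponents lie in
-- [0, (p-1)(q-1)] and r ≥ q, so at most p - 1 terms are nonzero, and height p - 1 forces p - 1
-- equal nonzero coefficients of Φ_pq along an arithmetic progression of difference r.  This already
-- gives the inequality.  With v q ≡ 1 (mod p), the exponents of Φ_pq with coefficient 1 (resp. -1)
-- are of the form i p + j q with 0 ≤ j < v (resp. 1 + i p + j q with 0 ≤ j < p - v); along the
-- progression the j are distinct, so v = p - 1 or v = 1, that is q ≡ ∓1 (mod p).  Then j changes by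
-- exactly one from term to term, whence r ≡ q (mod p).

open import Defs
open import Algebra.Bundles using (AbelianGroup; CommutativeRing)
import Algebra.Solver.Ring
open import Algebra.Solver.Ring.AlmostCommutativeRing using (fromCommutativeRing; _-Raw-AlmostCommutative⟶_)
open import Algebra.Structures using (IsCommutativeRing)
open import Data.Empty using (⊥)
open import Data.Fin using (Fin; toℕ; fromℕ<)
import Data.Fin.Properties as Finₚ
open import Data.Integer as ℤ using (ℤ; +_; -[1+_]; ∣_∣; 0ℤ; 1ℤ; -1ℤ; +≤+; -≤+)
import Data.Integer.Properties as ℤₚ
open import Algebra.Properties.Group (AbelianGroup.group ℤₚ.+-0-abelianGroup) using (∙-cancelʳ)
import Data.Integer.Tactic.RingSolver as ℤSolver
open import Data.List using ([]; _∷_; map; replicate; _++_; upTo)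
open import Data.List.Membership.Propositional using (_∈_)
open import Data.List.Membership.Propositional.Properties using (∈-map⁺; ∈-map⁻; ∈-++⁺ˡ; ∈-++⁺ʳ; ∈-++⁻; ∈-upTo⁺; ∈-filter⁺; ∈-filter⁻)
open import Data.List.Membership.Propositional.Properties.WithK using (unique∧set⇒bag)
open import Data.List.Relation.Binary.BagAndSetEquality using (∼bag⇒↭)
open import Data.List.Relation.Binary.Permutation.Propositional as ↭ using (_↭_; prep; swap; ↭-refl; ↭-trans)
import Data.List.Relation.Binary.Permutation.Propositional.Properties as ↭ₚ
open import Data.List.Relation.Unary.Unique.Propositional using (Unique)
import Data.List.Relation.Unary.Unique.Propositional.Properties as Uniqueₚ
import Data.Maybe
open import Data.Nat as ℕ using (ℕ; zero; suc; _<_; _≤_; _+_; _*_; _∸_; z≤n; s≤s; NonZero; _<?_)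
open import Data.Nat.Coprimality using (Coprime; coprime-Bézout; coprime-divisor; prime⇒coprime)
open import Data.Nat.Divisibility using (_∣_; _∣?_; divides; divides-refl; 0∣⇒≡0; ∣⇒≤; ∣1⇒≡1; m∣m*n; n∣m*n; ∣m⇒∣m*n; ∣n⇒∣m*n; m*n∣⇒m∣; *-cancelˡ-∣; *-monoʳ-∣; ∣m∣n⇒∣m+n; ∣m+n∣m⇒∣n)
open import Data.Nat.DivMod using (_/_; _%_; m≡m%n+[m/n]*n; m%n<n; m<n*o⇒m/o<n; m*n/n≡m; /-monoˡ-≤)
open import Data.Nat.GCD using (module Bézout)
open import Data.Nat.Primality using (Prime; prime⇒nonZero; prime⇒nonTrivial; prime⇒irreducible; euclidsLemma)
import Data.Nat.Properties as ℕₚ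
import Data.Nat.Tactic.RingSolver as ℕSolver
open import Data.Product using (_×_; _,_; proj₁; proj₂; ∃-syntax)
open import Data.Sum using (_⊎_; inj₁; inj₂)
open import Function.Bundles using (mk⇔)
open import Relation.Binary.Bundles using (Setoid)
import Relation.Binary.Reasoning.Setoid
open import Relation.Binary.Structures using (IsEquivalence)
open import Relation.Binary.PropositionalEquality using (_≡_; _≢_; refl; sym; trans; cong; cong₂; subst; subst₂; module ≡-Reasoning)
open import Relation.Nullary using (¬_; yes; no; contradiction)
open import Relation.Nullary.Decidable using (decidable-stable; dec⇒maybe)

-- The ring of polynomials

-- The family `Φ` is known only through products over divisors, and coefficient lists admit no
-- division. Quotient identities are therefore cross-multiplied: `Ψ` and the closed form `binary` of
-- Φ_pq enter through their products with factors x^p - 1, x^q - 1, x^r - 1, and these factors can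
-- be cancelled because their constant term is -1. That the p - 1 coefficients of Φ_pq are equal,
-- and not merely nonzero, comes from the shape of Ψ_pq: its coefficients are -1 on [0, p), 0 on [p,
-- q) and 1 on [q, q + p), so consecutive positions that avoid the zeros carry a single sign. The
-- congruence for r rests on v being extremal: every i p is then smaller than q, so a drop of the
-- exponent by r > q has to lower j.

coeff-+ : ∀ f g k → coeff (f +ₚ g) k ≡ coeff f k ℤ.+ coeff g k
coeff-+ []      g       k       = sym (ℤₚ.+-identityˡ _)
coeff-+ (a ∷ f) []      k       = sym (ℤₚ.+-identityʳ _)
coeff-+ (a ∷ f) (b ∷ g) zero    = refl
coeff-+ (a ∷ f) (b ∷ g) (suc k) = coeff-+ f g k

coeff-scale : ∀ c f k → coeff (scale c f) k ≡ c ℤ.* coeff f k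
coeff-scale c []      k       = sym (ℤₚ.*-zeroʳ c)
coeff-scale c (a ∷ f) zero    = refl
coeff-scale c (a ∷ f) (suc k) = coeff-scale c f k

infix 4 _≋_

-- A record, unlike _≈ₚ_ itself, lets the two polynomials be inferred from a proof.
record _≋_ (f g : Poly) : Set where
  constructor mk≋
  field at : f ≈ₚ g
open _≋_

≋-refl : ∀ {f} → f ≋ f
≋-refl = mk≋ λ _ → refl

≋-sym : ∀ {f g} → f ≋ g → g ≋ f
≋-sym (mk≋ e) = mk≋ λ k → sym (e k)

≋-trans : ∀ {f g h} → f ≋ g → g ≋ h → f ≋ h
≋-trans (mk≋ d) (mk≋ e) = mk≋ λ k → trans (d k) (e k)

∷-cong : ∀ {a b f g} → a ≡ b → f ≋ g → (a ∷ f) ≋ (b ∷ g)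
∷-cong a≡b (mk≋ e) = mk≋ λ { zero → a≡b ; (suc k) → e k }

∷-≋-tail : ∀ {a b f g} → (a ∷ f) ≋ (b ∷ g) → f ≋ g
∷-≋-tail (mk≋ e) = mk≋ λ k → e (suc k)

0∷[]≋[] : (0ℤ ∷ []) ≋ []
0∷[]≋[] = mk≋ λ { zero → refl ; (suc _) → refl }

+ₚ-cong : ∀ {f f′ g g′} → f ≋ f′ → g ≋ g′ → (f +ₚ g) ≋ (f′ +ₚ g′)
+ₚ-cong {f} {f′} {g} {g′} (mk≋ d) (mk≋ e) = mk≋ λ k →
  trans (coeff-+ f g k) (trans (cong₂ ℤ._+_ (d k) (e k)) (sym (coeff-+ f′ g′ k)))

scale-cong : ∀ c {f g} → f ≋ g → scale c f ≋ scale c g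
scale-cong c {f} {g} (mk≋ e) = mk≋ λ k →
  trans (coeff-scale c f k) (trans (cong (c ℤ.*_) (e k)) (sym (coeff-scale c g k)))

+ₚ-identityʳ : ∀ f → (f +ₚ []) ≋ f
+ₚ-identityʳ f = mk≋ λ k → trans (coeff-+ f [] k) (ℤₚ.+-identityʳ _)

+ₚ-comm : ∀ f g → (f +ₚ g) ≋ (g +ₚ f)
+ₚ-comm f g = mk≋ λ k →
  trans (coeff-+ f g k) (trans (ℤₚ.+-comm (coeff f k) _) (sym (coeff-+ g f k)))

+ₚ-assoc : ∀ f g h → ((f +ₚ g) +ₚ h) ≋ (f +ₚ (g +ₚ h))
+ₚ-assoc f g h = mk≋ λ k → begin
  coeff ((f +ₚ g) +ₚ h) k                   ≡⟨ coeff-+ (f +ₚ g) h k ⟩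
  coeff (f +ₚ g) k ℤ.+ coeff h k            ≡⟨ cong (ℤ._+ coeff h k) (coeff-+ f g k) ⟩
  coeff f k ℤ.+ coeff g k ℤ.+ coeff h k     ≡⟨ ℤₚ.+-assoc (coeff f k) _ _ ⟩
  coeff f k ℤ.+ (coeff g k ℤ.+ coeff h k)   ≡⟨ cong (ℤ._+_ (coeff f k)) (coeff-+ g h k) ⟨
  coeff f k ℤ.+ coeff (g +ₚ h) k            ≡⟨ coeff-+ f (g +ₚ h) k ⟨
  coeff (f +ₚ (g +ₚ h)) k                   ∎
  where open ≡-Reasoning

-ₚ_ : Poly → Poly
-ₚ_ = scale -1ℤ

+ₚ-inverseʳ : ∀ f → (f +ₚ (-ₚ f)) ≋ []
+ₚ-inverseʳ f = mk≋ λ k → begin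
  coeff (f +ₚ (-ₚ f)) k              ≡⟨ coeff-+ f (-ₚ f) k ⟩
  coeff f k ℤ.+ coeff (-ₚ f) k       ≡⟨ cong (ℤ._+_ (coeff f k)) (coeff-scale -1ℤ f k) ⟩
  coeff f k ℤ.+ -1ℤ ℤ.* coeff f k    ≡⟨ cong (ℤ._+_ (coeff f k)) (ℤₚ.-1*i≡-i (coeff f k)) ⟩
  coeff f k ℤ.- coeff f k            ≡⟨ ℤₚ.+-inverseʳ (coeff f k) ⟩
  0ℤ                                 ∎
  where open ≡-Reasoning

scale-distrib-+ₚ : ∀ c f g → scale c (f +ₚ g) ≋ (scale c f +ₚ scale c g)
scale-distrib-+ₚ c f g = mk≋ λ k → begin
  coeff (scale c (f +ₚ g)) k                     ≡⟨ coeff-scale c (f +ₚ g) k ⟩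
  c ℤ.* coeff (f +ₚ g) k                         ≡⟨ cong (c ℤ.*_) (coeff-+ f g k) ⟩
  c ℤ.* (coeff f k ℤ.+ coeff g k)                ≡⟨ ℤₚ.*-distribˡ-+ c (coeff f k) _ ⟩
  c ℤ.* coeff f k ℤ.+ c ℤ.* coeff g k            ≡⟨ cong₂ ℤ._+_ (coeff-scale c f k) (coeff-scale c g k) ⟨
  coeff (scale c f) k ℤ.+ coeff (scale c g) k    ≡⟨ coeff-+ (scale c f) (scale c g) k ⟨
  coeff (scale c f +ₚ scale c g) k               ∎
  where open ≡-Reasoning

scale-+ : ∀ a b f → scale (a ℤ.+ b) f ≋ (scale a f +ₚ scale b f)
scale-+ a b f = mk≋ λ k → begin
  coeff (scale (a ℤ.+ b) f) k                    ≡⟨ coeff-scale (a ℤ.+ b) f k ⟩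
  (a ℤ.+ b) ℤ.* coeff f k                        ≡⟨ ℤₚ.*-distribʳ-+ (coeff f k) a b ⟩
  a ℤ.* coeff f k ℤ.+ b ℤ.* coeff f k            ≡⟨ cong₂ ℤ._+_ (coeff-scale a f k) (coeff-scale b f k) ⟨
  coeff (scale a f) k ℤ.+ coeff (scale b f) k    ≡⟨ coeff-+ (scale a f) (scale b f) k ⟨
  coeff (scale a f +ₚ scale b f) k               ∎
  where open ≡-Reasoning

scale-scale : ∀ a b f → scale a (scale b f) ≋ scale (a ℤ.* b) f
scale-scale a b f = mk≋ λ k → begin
  coeff (scale a (scale b f)) k    ≡⟨ coeff-scale a (scale b f) k ⟩
  a ℤ.* coeff (scale b f) k        ≡⟨ cong (a ℤ.*_) (coeff-scale b f k) ⟩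
  a ℤ.* (b ℤ.* coeff f k)          ≡⟨ ℤₚ.*-assoc a b _ ⟨
  a ℤ.* b ℤ.* coeff f k            ≡⟨ coeff-scale (a ℤ.* b) f k ⟨
  coeff (scale (a ℤ.* b) f) k      ∎
  where open ≡-Reasoning

scale-1 : ∀ f → scale 1ℤ f ≋ f
scale-1 f = mk≋ λ k → trans (coeff-scale 1ℤ f k) (ℤₚ.*-identityˡ _)

scale-0 : ∀ f → scale 0ℤ f ≋ []
scale-0 f = mk≋ λ k → trans (coeff-scale 0ℤ f k) (ℤₚ.*-zeroˡ (coeff f k))

≋-isEquivalence : IsEquivalence _≋_
≋-isEquivalence = record { refl = ≋-refl ; sym = ≋-sym ; trans = ≋-trans }

Poly-setoid : Setoid _ _
Poly-setoid = record { isEquivalence = ≋-isEquivalence }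

module ≋-Reasoning = Relation.Binary.Reasoning.Setoid Poly-setoid

+ₚ-interchange : ∀ f g h i → ((f +ₚ g) +ₚ (h +ₚ i)) ≋ ((f +ₚ h) +ₚ (g +ₚ i))
+ₚ-interchange f g h i = begin
  (f +ₚ g) +ₚ (h +ₚ i)    ≈⟨ +ₚ-assoc f g _ ⟩
  f +ₚ (g +ₚ (h +ₚ i))    ≈⟨ +ₚ-cong (≋-refl {f}) (≋-sym (+ₚ-assoc g h i)) ⟩
  f +ₚ ((g +ₚ h) +ₚ i)    ≈⟨ +ₚ-cong (≋-refl {f}) (+ₚ-cong (+ₚ-comm g h) ≋-refl) ⟩
  f +ₚ ((h +ₚ g) +ₚ i)    ≈⟨ +ₚ-cong (≋-refl {f}) (+ₚ-assoc h g i) ⟩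
  f +ₚ (h +ₚ (g +ₚ i))    ≈⟨ +ₚ-assoc f h _ ⟨
  (f +ₚ h) +ₚ (g +ₚ i)    ∎
  where open ≋-Reasoning

*ₚ-zeroʳ : ∀ f → (f *ₚ []) ≋ []
*ₚ-zeroʳ []      = ≋-refl
*ₚ-zeroʳ (a ∷ f) = ≋-trans (∷-cong refl (*ₚ-zeroʳ f)) 0∷[]≋[]

*ₚ-congʳ : ∀ f {g h} → g ≋ h → (f *ₚ g) ≋ (f *ₚ h)
*ₚ-congʳ []      e = ≋-refl
*ₚ-congʳ (a ∷ f) e = +ₚ-cong (scale-cong a e) (∷-cong refl (*ₚ-congʳ f e))

*ₚ-∷ : ∀ f b g → (f *ₚ (b ∷ g)) ≋ (scale b f +ₚ (0ℤ ∷ (f *ₚ g)))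
*ₚ-∷ []      b g = ≋-sym 0∷[]≋[]
*ₚ-∷ (a ∷ f) b g = ∷-cong
  (cong (ℤ._+ 0ℤ) (ℤₚ.*-comm a b))
  (begin
    scale a g +ₚ (f *ₚ (b ∷ g))                       ≈⟨ +ₚ-cong (≋-refl {scale a g}) (*ₚ-∷ f b g) ⟩
    scale a g +ₚ (scale b f +ₚ (0ℤ ∷ (f *ₚ g)))       ≈⟨ +ₚ-assoc (scale a g) _ _ ⟨
    (scale a g +ₚ scale b f) +ₚ (0ℤ ∷ (f *ₚ g))       ≈⟨ +ₚ-cong (+ₚ-comm (scale a g) _) ≋-refl ⟩
    (scale b f +ₚ scale a g) +ₚ (0ℤ ∷ (f *ₚ g))       ≈⟨ +ₚ-assoc (scale b f) _ _ ⟩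
    scale b f +ₚ (scale a g +ₚ (0ℤ ∷ (f *ₚ g)))       ∎)
  where open ≋-Reasoning

*ₚ-comm : ∀ f g → (f *ₚ g) ≋ (g *ₚ f)
*ₚ-comm []      g = ≋-sym (*ₚ-zeroʳ g)
*ₚ-comm (a ∷ f) g =
  ≋-trans (+ₚ-cong (≋-refl {scale a g}) (∷-cong refl (*ₚ-comm f g))) (≋-sym (*ₚ-∷ g a f))

*ₚ-cong : ∀ {f f′ g g′} → f ≋ f′ → g ≋ g′ → (f *ₚ g) ≋ (f′ *ₚ g′)
*ₚ-cong {f} {f′} {g} {g′} d e = begin
  f *ₚ g      ≈⟨ *ₚ-congʳ f e ⟩
  f *ₚ g′     ≈⟨ *ₚ-comm f g′ ⟩
  g′ *ₚ f     ≈⟨ *ₚ-congʳ g′ d ⟩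
  g′ *ₚ f′    ≈⟨ *ₚ-comm g′ f′ ⟩
  f′ *ₚ g′    ∎
  where open ≋-Reasoning

*ₚ-distribʳ : ∀ h f g → ((f +ₚ g) *ₚ h) ≋ ((f *ₚ h) +ₚ (g *ₚ h))
*ₚ-distribʳ h []      g       = ≋-refl
*ₚ-distribʳ h (a ∷ f) []      = ≋-sym (+ₚ-identityʳ _)
*ₚ-distribʳ h (a ∷ f) (b ∷ g) = ≋-trans
  (+ₚ-cong (scale-+ a b h) (∷-cong refl (*ₚ-distribʳ h f g)))
  (+ₚ-interchange (scale a h) (scale b h) (0ℤ ∷ (f *ₚ h)) (0ℤ ∷ (g *ₚ h)))

scale-*ₚ : ∀ a g h → (scale a g *ₚ h) ≋ scale a (g *ₚ h)
scale-*ₚ a []      h = ≋-refl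
scale-*ₚ a (b ∷ g) h = begin
  scale (a ℤ.* b) h +ₚ (0ℤ ∷ (scale a g *ₚ h))
    ≈⟨ +ₚ-cong (≋-sym (scale-scale a b h)) (∷-cong (sym (ℤₚ.*-zeroʳ a)) (scale-*ₚ a g h)) ⟩
  scale a (scale b h) +ₚ scale a (0ℤ ∷ (g *ₚ h))
    ≈⟨ scale-distrib-+ₚ a (scale b h) _ ⟨
  scale a (scale b h +ₚ (0ℤ ∷ (g *ₚ h)))          ∎
  where open ≋-Reasoning

0∷-*ₚ : ∀ f g → ((0ℤ ∷ f) *ₚ g) ≋ (0ℤ ∷ (f *ₚ g))
0∷-*ₚ f g = +ₚ-cong (scale-0 g) ≋-refl

*ₚ-assoc : ∀ f g h → ((f *ₚ g) *ₚ h) ≋ (f *ₚ (g *ₚ h))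
*ₚ-assoc []      g h = ≋-refl
*ₚ-assoc (a ∷ f) g h = begin
  (scale a g +ₚ (0ℤ ∷ (f *ₚ g))) *ₚ h              ≈⟨ *ₚ-distribʳ h (scale a g) _ ⟩
  (scale a g *ₚ h) +ₚ ((0ℤ ∷ (f *ₚ g)) *ₚ h)       ≈⟨ +ₚ-cong (scale-*ₚ a g h) (0∷-*ₚ (f *ₚ g) h) ⟩
  scale a (g *ₚ h) +ₚ (0ℤ ∷ ((f *ₚ g) *ₚ h))       ≈⟨ +ₚ-cong (≋-refl {scale a (g *ₚ h)}) (∷-cong refl (*ₚ-assoc f g h)) ⟩
  scale a (g *ₚ h) +ₚ (0ℤ ∷ (f *ₚ (g *ₚ h)))       ∎
  where open ≋-Reasoning

*ₚ-identityˡ : ∀ f → (oneₚ *ₚ f) ≋ f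
*ₚ-identityˡ f = ≋-trans (+ₚ-cong (scale-1 f) 0∷[]≋[]) (+ₚ-identityʳ f)

Poly-isCommutativeRing : IsCommutativeRing _≋_ _+ₚ_ _*ₚ_ -ₚ_ [] oneₚ
Poly-isCommutativeRing = record
  { isRing = record
    { +-isAbelianGroup = record
      { isGroup = record
        { isMonoid = record
          { isSemigroup = record
            { isMagma = record { isEquivalence = ≋-isEquivalence ; ∙-cong = +ₚ-cong }
            ; assoc = +ₚ-assoc }
          ; identity = (λ _ → ≋-refl) , +ₚ-identityʳ }
        ; inverse = (λ f → ≋-trans (+ₚ-comm (-ₚ f) f) (+ₚ-inverseʳ f)) , +ₚ-inverseʳ
        ; ⁻¹-cong = scale-cong -1ℤ }
      ; comm = +ₚ-comm }
    ; *-cong = *ₚ-cong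
    ; *-assoc = *ₚ-assoc
    ; *-identity = *ₚ-identityˡ , λ f → ≋-trans (*ₚ-comm f oneₚ) (*ₚ-identityˡ f)
    ; distrib = (λ f g h → ≋-trans (*ₚ-comm f (g +ₚ h))
                  (≋-trans (*ₚ-distribʳ f g h) (+ₚ-cong (*ₚ-comm g f) (*ₚ-comm h f))))
              , *ₚ-distribʳ }
  ; *-comm = *ₚ-comm }

Poly-commutativeRing : CommutativeRing _ _
Poly-commutativeRing = record { isCommutativeRing = Poly-isCommutativeRing }

-- Makes integer constants available to the ring solver, so that it can expand x^n - 1. Zero is sent
-- to `0ℤ ∷ []`, which is `[]` only up to trailing zeros.
const-homomorphism : ℤ.+-*-rawRing -Raw-AlmostCommutative⟶ fromCommutativeRing Poly-commutativeRing
const-homomorphism = record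
  { ⟦_⟧    = λ c → c ∷ []
  ; +-homo = λ _ _ → ≋-refl
  ; *-homo = λ a b → ∷-cong (sym (ℤₚ.+-identityʳ (a ℤ.* b))) ≋-refl
  ; -‿homo = λ a → ∷-cong (sym (ℤₚ.-1*i≡-i a)) ≋-refl
  ; 0-homo = 0∷[]≋[]
  ; 1-homo = ≋-refl
  }

module PolySolver = Algebra.Solver.Ring ℤ.+-*-rawRing (fromCommutativeRing Poly-commutativeRing)
  const-homomorphism (λ a b → Data.Maybe.map (λ a≡b → ∷-cong a≡b ≋-refl) (dec⇒maybe (a ℤₚ.≟ b)))

-- Cancellation of a factor with nonzero constant term

*ₚ-0∷ : ∀ f d → (f *ₚ (0ℤ ∷ d)) ≋ (0ℤ ∷ (f *ₚ d))
*ₚ-0∷ f d = ≋-trans (*ₚ-∷ f 0ℤ d) (+ₚ-cong (scale-0 f) ≋-refl)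

coeff-*-0 : ∀ f g → coeff (f *ₚ g) 0 ≡ coeff f 0 ℤ.* coeff g 0
coeff-*-0 []      g = sym (ℤₚ.*-zeroˡ (coeff g 0))
coeff-*-0 (a ∷ f) g = begin
  coeff (scale a g +ₚ (0ℤ ∷ (f *ₚ g))) 0    ≡⟨ coeff-+ (scale a g) _ 0 ⟩
  coeff (scale a g) 0 ℤ.+ 0ℤ                ≡⟨ ℤₚ.+-identityʳ _ ⟩
  coeff (scale a g) 0                       ≡⟨ coeff-scale a g 0 ⟩
  a ℤ.* coeff g 0                           ∎
  where open ≡-Reasoning

-- The constant term of the product is that of `f` times the head of `d`, so the head of `d`
-- vanishes; it is split off as a factor x and the argument repeats on the tail.
*ₚ-≋0⇒≋0 : ∀ f d → coeff f 0 ≢ 0ℤ → (f *ₚ d) ≋ [] → d ≋ []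
*ₚ-≋0⇒≋0 f []      f₀≢0 e = ≋-refl
*ₚ-≋0⇒≋0 f (b ∷ d) f₀≢0 e with ℤₚ.i*j≡0⇒i≡0∨j≡0 (coeff f 0) (trans (sym (coeff-*-0 f (b ∷ d))) (at e 0))
... | inj₁ f₀≡0 = contradiction f₀≡0 f₀≢0
... | inj₂ refl = ≋-trans (∷-cong refl d≋0) 0∷[]≋[]
  where
  d≋0 : d ≋ []
  d≋0 = *ₚ-≋0⇒≋0 f d f₀≢0
    (∷-≋-tail (≋-trans (≋-trans (≋-sym (*ₚ-0∷ f d)) e) (≋-sym 0∷[]≋[])))

*ₚ-cancelˡ : ∀ f {g h} → coeff f 0 ≢ 0ℤ → (f *ₚ g) ≋ (f *ₚ h) → g ≋ h
*ₚ-cancelˡ f {g} {h} f₀≢0 e = begin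
  g                         ≈⟨ +ₚ-identityʳ g ⟨
  g +ₚ []                   ≈⟨ +ₚ-cong (≋-refl {g}) (+ₚ-inverseʳ h) ⟨
  g +ₚ (h +ₚ (-ₚ h))        ≈⟨ solve 2 (λ g h → g :+ (h :+ :- h) := (g :+ :- h) :+ h) (λ {_} → ≋-refl) g h ⟩
  (g +ₚ (-ₚ h)) +ₚ h        ≈⟨ +ₚ-cong d≋0 ≋-refl ⟩
  h                         ∎
  where
  open ≋-Reasoning
  open PolySolver
  d≋0 : (g +ₚ (-ₚ h)) ≋ []
  d≋0 = *ₚ-≋0⇒≋0 f _ f₀≢0 (begin
    f *ₚ (g +ₚ (-ₚ h))             ≈⟨ solve 3 (λ f g h → f :* (g :+ :- h) := f :* g :+ :- (f :* h)) (λ {_} → ≋-refl) f g h ⟩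
    (f *ₚ g) +ₚ (-ₚ (f *ₚ h))      ≈⟨ +ₚ-cong e ≋-refl ⟩
    (f *ₚ h) +ₚ (-ₚ (f *ₚ h))      ≈⟨ +ₚ-inverseʳ (f *ₚ h) ⟩
    []                             ∎)

-- Geometric sums and a closed form of Φ_pq

X^ : ℕ → Poly
X^ n = replicate n 0ℤ ++ oneₚ

-- x^n - 1 as a difference, a form the ring solver can expand. Also `E 0` is zero, as telescoping
-- requires, whereas `xpow-1 0` is x - 1.
E : ℕ → Poly
E n = X^ n +ₚ (-ₚ oneₚ)

xpow-1≋E : ∀ {n} → 1 ≤ n → xpow-1 n ≋ E n
xpow-1≋E {suc n} _ = ∷-cong refl (≋-sym (+ₚ-identityʳ (X^ n)))

E₀≢0 : ∀ {n} → 1 ≤ n → coeff (E n) 0 ≢ 0ℤ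
E₀≢0 {suc n} _ ()

X^suc-*ₚ : ∀ n f → (X^ (suc n) *ₚ f) ≋ (0ℤ ∷ (X^ n *ₚ f))
X^suc-*ₚ n f = 0∷-*ₚ (X^ n) f

X^-+ : ∀ m n → (X^ m *ₚ X^ n) ≋ X^ (m + n)
X^-+ zero    n = *ₚ-identityˡ (X^ n)
X^-+ (suc m) n = ≋-trans (X^suc-*ₚ m (X^ n)) (∷-cong refl (X^-+ m n))

coeff-X^-≥ : ∀ n f k → coeff (X^ n *ₚ f) (n + k) ≡ coeff f k
coeff-X^-≥ zero    f k = at (*ₚ-identityˡ f) k
coeff-X^-≥ (suc n) f k = trans (at (X^suc-*ₚ n f) (suc (n + k))) (coeff-X^-≥ n f k)

coeff-X^-< : ∀ n f {k} → k < n → coeff (X^ n *ₚ f) k ≡ 0ℤ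
coeff-X^-< (suc n) f {zero}  _         = at (X^suc-*ₚ n f) 0
coeff-X^-< (suc n) f {suc k} (s≤s k<n) = trans (at (X^suc-*ₚ n f) (suc k)) (coeff-X^-< n f k<n)

coeff-X^-≢0 : ∀ n f k → coeff (X^ n *ₚ f) k ≢ 0ℤ →
              ∃[ m ] (k ≡ n + m) × (coeff (X^ n *ₚ f) k ≡ coeff f m)
coeff-X^-≢0 n f k ≢0 with ℕₚ.<-≤-connex k n
... | inj₁ k<n = contradiction (coeff-X^-< n f k<n) ≢0
... | inj₂ n≤k = k ∸ n , sym (ℕₚ.m+[n∸m]≡n n≤k) ,
  trans (cong (coeff (X^ n *ₚ f)) (sym (ℕₚ.m+[n∸m]≡n n≤k))) (coeff-X^-≥ n f (k ∸ n))

-- 1 + x^s + ⋯ + x^((u-1)s), the quotient of x^(us) - 1 by x^s - 1.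
geom : ℕ → ℕ → Poly
geom s zero    = []
geom s (suc u) = geom s u +ₚ X^ (u * s)

module _ where
  open PolySolver
  open ≋-Reasoning

  E*geom : ∀ s u → (E s *ₚ geom s u) ≋ E (u * s)
  E*geom s zero    = ≋-trans (*ₚ-zeroʳ (E s)) (≋-sym (+ₚ-inverseʳ oneₚ))
  E*geom s (suc u) = begin
    E s *ₚ (geom s u +ₚ X^ (u * s))
      ≈⟨ solve 3 (λ x g y → (x :+ :- con 1ℤ) :* (g :+ y) :=
                            (x :+ :- con 1ℤ) :* g :+ (x :* y :+ :- y)) (λ {_} → ≋-refl)
           (X^ s) (geom s u) (X^ (u * s)) ⟩
    (E s *ₚ geom s u) +ₚ ((X^ s *ₚ X^ (u * s)) +ₚ (-ₚ X^ (u * s)))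
      ≈⟨ +ₚ-cong (E*geom s u) (+ₚ-cong (X^-+ s (u * s)) ≋-refl) ⟩
    E (u * s) +ₚ (X^ (s + u * s) +ₚ (-ₚ X^ (u * s)))
      ≈⟨ solve 2 (λ y z → (y :+ :- con 1ℤ) :+ (z :+ :- y) := z :+ :- con 1ℤ) (λ {_} → ≋-refl)
           (X^ (u * s)) (X^ (s + u * s)) ⟩
    E (suc u * s)                                         ∎

  -- A closed form of Φ_pq, for v an inverse of q modulo p.
  binary : (p q u v t w : ℕ) → Poly
  binary p q u v t w = (geom p u *ₚ geom q v) +ₚ (-ₚ (X^ 1 *ₚ (geom p t *ₚ geom q w)))

  -- This is the identity Φ_pq (x^p - 1)(x^q - 1) = (x^pq - 1)(x - 1). The geometric sums telescope,
  -- and the exponents satisfy 1 + t p = v q, 1 + w q = u p and u p + v q = 1 + p q, so all mixed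
  -- terms cancel.
  binary*E*E : ∀ p q u v t w → u + t ≡ q → v + w ≡ p → v * q ≡ 1 + t * p →
               ((binary p q u v t w *ₚ E p) *ₚ E q) ≋ (E (p * q) *ₚ E 1)
  binary*E*E p q u v t w u+t≡q v+w≡p vq≡1+tp = begin
    (binary p q u v t w *ₚ E p) *ₚ E q
      ≈⟨ solve 7 (λ a b c d x e f →
                    ((a :* b :+ :- (x :* (c :* d))) :* e) :* f :=
                    (e :* a) :* (f :* b) :+ :- (x :* ((e :* c) :* (f :* d)))) (λ {_} → ≋-refl)
           (geom p u) (geom q v) (geom p t) (geom q w) x (E p) (E q) ⟩
    ((E p *ₚ geom p u) *ₚ (E q *ₚ geom q v)) +ₚ (-ₚ (x *ₚ ((E p *ₚ geom p t) *ₚ (E q *ₚ geom q w))))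
      ≈⟨ +ₚ-cong (*ₚ-cong (E*geom p u) (E*geom q v))
           (-ₚ-cong (*ₚ-congʳ x (*ₚ-cong (E*geom p t) (E*geom q w)))) ⟩
    (E (u * p) *ₚ E (v * q)) +ₚ (-ₚ (x *ₚ (E (t * p) *ₚ E (w * q))))
      ≈⟨ solve 5 (λ U V T W x →
                    (U :+ :- con 1ℤ) :* (V :+ :- con 1ℤ) :+
                      :- (x :* ((T :+ :- con 1ℤ) :* (W :+ :- con 1ℤ))) :=
                    (U :* V :+ (:- U :+ :- V)) :+ ((:- ((x :* T) :* W) :+ (x :* T :+ x :* W)) :+ (con 1ℤ :+ :- x)))
           (λ {_} → ≋-refl) U V T W x ⟩
    ((U *ₚ V) +ₚ ((-ₚ U) +ₚ (-ₚ V)))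
      +ₚ (((-ₚ ((x *ₚ T) *ₚ W)) +ₚ ((x *ₚ T) +ₚ (x *ₚ W))) +ₚ (oneₚ +ₚ (-ₚ x)))
      ≈⟨ +ₚ-cong (+ₚ-cong UV ≋-refl)
           (+ₚ-cong (+ₚ-cong (-ₚ-cong (≋-trans (*ₚ-cong xT (≋-refl {W})) VW)) (+ₚ-cong xT xW)) ≋-refl) ⟩
    ((x *ₚ N) +ₚ ((-ₚ U) +ₚ (-ₚ V))) +ₚ (((-ₚ N) +ₚ (V +ₚ U)) +ₚ (oneₚ +ₚ (-ₚ x)))
      ≈⟨ solve 4 (λ x N U V →
                    (x :* N :+ (:- U :+ :- V)) :+ ((:- N :+ (V :+ U)) :+ (con 1ℤ :+ :- x)) :=
                    (N :+ :- con 1ℤ) :* (x :+ :- con 1ℤ)) (λ {_} → ≋-refl) x N U V ⟩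
    E (p * q) *ₚ E 1    ∎
    where
    x = X^ 1
    U = X^ (u * p)
    V = X^ (v * q)
    T = X^ (t * p)
    W = X^ (w * q)
    N = X^ (p * q)
    -ₚ-cong : ∀ {f g} → f ≋ g → (-ₚ f) ≋ (-ₚ g)
    -ₚ-cong = scale-cong -1ℤ
    X^-≡ : ∀ {m n k l} → m + n ≡ k → k ≡ l → (X^ m *ₚ X^ n) ≋ X^ l
    X^-≡ {m} {n} refl refl = X^-+ m n
    vq+wq≡pq : v * q + w * q ≡ p * q
    vq+wq≡pq = trans (sym (ℕₚ.*-distribʳ-+ q v w)) (cong (_* q) v+w≡p)
    up+tp≡pq : u * p + t * p ≡ p * q
    up+tp≡pq = trans (sym (ℕₚ.*-distribʳ-+ p u t)) (trans (cong (_* p) u+t≡q) (ℕₚ.*-comm q p))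
    up+vq≡1+pq : u * p + v * q ≡ 1 + p * q
    up+vq≡1+pq = trans (cong (_+_ (u * p)) vq≡1+tp) (trans (ℕₚ.+-suc (u * p) _) (cong suc up+tp≡pq))
    UV : (U *ₚ V) ≋ (x *ₚ N)
    UV = ≋-trans (X^-≡ {u * p} {v * q} up+vq≡1+pq refl) (≋-sym (X^-+ 1 (p * q)))
    xT : (x *ₚ T) ≋ V
    xT = X^-≡ {1} {t * p} (sym vq≡1+tp) refl
    VW : (V *ₚ W) ≋ N
    VW = X^-≡ {v * q} {w * q} vq+wq≡pq refl
    xW : (x *ₚ W) ≋ U
    xW = X^-≡ {1} {w * q} refl (ℕₚ.+-cancelʳ-≡ (v * q) _ _
      (trans (cong suc (trans (ℕₚ.+-comm (w * q) _) vq+wq≡pq)) (sym up+vq≡1+pq)))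

-- Products over divisors

module _ where
  open ≋-Reasoning

  productₚ-↭ : ∀ {fs gs} → fs ↭ gs → productₚ fs ≋ productₚ gs
  productₚ-↭ ↭.refl        = ≋-refl
  productₚ-↭ (prep f s)    = *ₚ-congʳ f (productₚ-↭ s)
  productₚ-↭ {_ ∷ _ ∷ fs} {_ ∷ _ ∷ gs} (swap f g s) = begin
    f *ₚ (g *ₚ productₚ fs)    ≈⟨ *ₚ-assoc f g _ ⟨
    (f *ₚ g) *ₚ productₚ fs    ≈⟨ *ₚ-cong (*ₚ-comm f g) (productₚ-↭ s) ⟩
    (g *ₚ f) *ₚ productₚ gs    ≈⟨ *ₚ-assoc g f _ ⟩
    g *ₚ (f *ₚ productₚ gs)    ∎
  productₚ-↭ (↭.trans s t) = ≋-trans (productₚ-↭ s) (productₚ-↭ t)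

divisors-unique : ∀ n → Unique (divisors n)
divisors-unique n = Uniqueₚ.filter⁺ (_∣? n) (Uniqueₚ.map⁺ ℕₚ.suc-injective (Uniqueₚ.upTo⁺ n))

∈-divisors⁺ : ∀ {n d} .{{_ : NonZero n}} → d ∣ n → d ∈ divisors n
∈-divisors⁺ {suc n} {zero}  0∣n = contradiction (0∣⇒≡0 0∣n) λ ()
∈-divisors⁺ {suc n} {suc d} d∣n = ∈-filter⁺ (_∣? suc n) (∈-map⁺ suc (∈-upTo⁺ (∣⇒≤ d∣n))) d∣n

∈-divisors⁻ : ∀ {n d} → d ∈ divisors n → d ∣ n
∈-divisors⁻ {n} d∈ = proj₂ (∈-filter⁻ (_∣? n) {xs = map suc (upTo n)} d∈)

-- In p m = c d the prime p divides the cofactor c or the divisor d.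
∣-prime-* : ∀ {p m d} → Prime p → d ∣ p * m → d ∣ m ⊎ (∃[ e ] (e ∣ m) × (d ≡ p * e))
∣-prime-* {p} {m} {d} pp (divides c pm≡cd) with euclidsLemma c d pp (subst (p ∣_) pm≡cd (m∣m*n m))
... | inj₁ (divides-refl c′) = inj₁ (divides c′ (ℕₚ.*-cancelˡ-≡ m _ p (begin
  p * m          ≡⟨ pm≡cd ⟩
  c′ * p * d     ≡⟨ cong (_* d) (ℕₚ.*-comm c′ p) ⟩
  p * c′ * d     ≡⟨ ℕₚ.*-assoc p c′ d ⟩
  p * (c′ * d)   ∎)))
  where
  open ≡-Reasoning
  instance _ = prime⇒nonZero pp
... | inj₂ (divides e d≡ep) = inj₂ (e , *-cancelˡ-∣ p (subst (_∣ p * m) d≡pe (divides c pm≡cd)) , d≡pe)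
  where
  d≡pe = trans d≡ep (ℕₚ.*-comm e p)
  instance _ = prime⇒nonZero pp

-- Both lists are free of repetitions and have the same members, hence are permutations of each
-- other. The hypothesis ¬ p ∣ m keeps the two halves of the right-hand list disjoint.
divisors-prime-* : ∀ {p m ds} .{{_ : NonZero m}} → Prime p → ¬ p ∣ m → divisors m ↭ ds →
                   divisors (p * m) ↭ ds ++ map (p *_) ds
divisors-prime-* {p} {m} pp p∤m σ = ↭-trans
  (∼bag⇒↭ (unique∧set⇒bag (divisors-unique (p * m)) unique-rhs (mk⇔ to from)))
  (↭ₚ.++⁺ σ (↭ₚ.map⁺ (p *_) σ))
  where
  instance
    _ = prime⇒nonZero pp
    _ = ℕₚ.m*n≢0 p m
  unique-rhs : Unique (divisors m ++ map (p *_) (divisors m))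
  unique-rhs = Uniqueₚ.++⁺ (divisors-unique m)
    (Uniqueₚ.map⁺ (ℕₚ.*-cancelˡ-≡ _ _ p) (divisors-unique m)) disjoint
    where
    disjoint : ∀ {d} → ¬ (d ∈ divisors m × d ∈ map (p *_) (divisors m))
    disjoint (d∈ , pe∈) with e , _ , refl ← ∈-map⁻ (p *_) pe∈ =
      p∤m (m*n∣⇒m∣ p e (∈-divisors⁻ d∈))
  to : ∀ {d} → d ∈ divisors (p * m) → d ∈ divisors m ++ map (p *_) (divisors m)
  to d∈ with ∣-prime-* pp (∈-divisors⁻ d∈)
  ... | inj₁ d∣m              = ∈-++⁺ˡ (∈-divisors⁺ d∣m)
  ... | inj₂ (e , e∣m , refl) = ∈-++⁺ʳ (divisors m) (∈-map⁺ (p *_) (∈-divisors⁺ e∣m))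
  from : ∀ {d} → d ∈ divisors m ++ map (p *_) (divisors m) → d ∈ divisors (p * m)
  from d∈ with ∈-++⁻ (divisors m) d∈
  ... | inj₁ d∈m = ∈-divisors⁺ (∣n⇒∣m*n p (∈-divisors⁻ d∈m))
  ... | inj₂ pe∈ with e , e∈ , refl ← ∈-map⁻ (p *_) pe∈ =
    ∈-divisors⁺ (*-monoʳ-∣ p (∈-divisors⁻ e∈))

prime>1 : ∀ {p} → Prime p → 1 < p
prime>1 {suc (suc _)} _ = s≤s (s≤s z≤n)
prime>1 {1} pp with () ← prime⇒nonTrivial pp
prime>1 {0} pp with () ← prime⇒nonTrivial pp

prime∤1 : ∀ {p} → Prime p → ¬ p ∣ 1
prime∤1 pp p∣1 = ℕₚ.<⇒≢ (prime>1 pp) (sym (∣1⇒≡1 p∣1))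

prime∤* : ∀ {p q m} → Prime p → Prime q → p ≢ q → ¬ p ∣ m → ¬ p ∣ q * m
prime∤* {p} {q} {m} pp pq p≢q p∤m p∣qm with euclidsLemma q m pp p∣qm
... | inj₂ p∣m = p∤m p∣m
... | inj₁ p∣q with prime⇒irreducible pq p∣q
...   | inj₁ refl = ℕₚ.<⇒≢ (prime>1 pp) refl
...   | inj₂ p≡q  = p≢q p≡q

module _ {Φ : ℕ → Poly} (cyc : IsCyclotomic Φ) where

  productₚ-divisors : ∀ n {ds} .{{_ : NonZero n}} → divisors n ↭ ds → productₚ (map Φ ds) ≋ E n
  productₚ-divisors n σ = ≋-trans (productₚ-↭ (↭ₚ.map⁺ Φ (↭.↭-sym σ)))
    (≋-trans (mk≋ (cyc n (ℕ.>-nonZero⁻¹ n))) (xpow-1≋E (ℕ.>-nonZero⁻¹ n)))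

  module _ {p q r Ψ} (pp : Prime p) (pq : Prime q) (pr : Prime r)
           (p≢q : p ≢ q) (p≢r : p ≢ r) (q≢r : q ≢ r)
           (ΨΦ : Ψ *ₚ Φ (p * q * r) ≈ₚ xpow-1 (p * q * r)) where

    private
      instance
        p≢0 = prime⇒nonZero pp
        q≢0 = prime⇒nonZero pq
        r≢0 = prime⇒nonZero pr
        p1≢0 = ℕₚ.m*n≢0 p 1
        q1≢0 = ℕₚ.m*n≢0 q 1
        r1≢0 = ℕₚ.m*n≢0 r 1
        pq1≢0 = ℕₚ.m*n≢0 p (q * 1)
        pr1≢0 = ℕₚ.m*n≢0 p (r * 1)
        qr1≢0 = ℕₚ.m*n≢0 q (r * 1)
        pqr1≢0 = ℕₚ.m*n≢0 p (q * (r * 1))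

      -- Every list is grown from the divisors of 1 by one prime at a time, so that `Φ` receives
      -- literally the same arguments, such as `p * (q * 1)`, in all of them. The factors 1
      -- disappear only in the equations passed to `E≡`.
      σ₁ : divisors 1 ↭ 1 ∷ []
      σ₁ = ↭-refl
      σp : divisors (p * 1) ↭ _
      σp = divisors-prime-* pp (prime∤1 pp) σ₁
      σq : divisors (q * 1) ↭ _
      σq = divisors-prime-* pq (prime∤1 pq) σ₁
      σr : divisors (r * 1) ↭ _
      σr = divisors-prime-* pr (prime∤1 pr) σ₁
      σpq : divisors (p * (q * 1)) ↭ _
      σpq = divisors-prime-* pp (prime∤* pp pq p≢q (prime∤1 pp)) σq
      σpr : divisors (p * (r * 1)) ↭ _
      σpr = divisors-prime-* pp (prime∤* pp pr p≢r (prime∤1 pp)) σr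
      σqr : divisors (q * (r * 1)) ↭ _
      σqr = divisors-prime-* pq (prime∤* pq pr q≢r (prime∤1 pq)) σr
      σpqr : divisors (p * (q * (r * 1))) ↭ _
      σpqr = divisors-prime-* pp (prime∤* pp pq p≢q (prime∤* pp pr p≢r (prime∤1 pp))) σqr

      E≡ : ∀ m {n ds} .{{_ : NonZero m}} → m ≡ n → divisors m ↭ ds → E n ≋ productₚ (map Φ ds)
      E≡ m refl σ = ≋-sym (productₚ-divisors m σ)

      pqr≡ : p * (q * (r * 1)) ≡ p * q * r
      pqr≡ = trans (cong (λ x → p * (q * x)) (ℕₚ.*-identityʳ r)) (sym (ℕₚ.*-assoc p q r))

      1≤pqr : 1 ≤ p * q * r
      1≤pqr = subst (1 ≤_) pqr≡ (ℕ.>-nonZero⁻¹ (p * (q * (r * 1))))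

      -- The eight cyclotomic factors of x^pqr - 1 in the order in which `σpqr` lists them; `z` is
      -- Φ_pqr.
      a b c d e f g z : Poly
      a = Φ 1
      b = Φ (r * 1)
      c = Φ (q * 1)
      d = Φ (q * (r * 1))
      e = Φ (p * 1)
      f = Φ (p * (r * 1))
      g = Φ (p * (q * 1))
      z = Φ (p * (q * (r * 1)))

      Ψz≋E : (Ψ *ₚ z) ≋ E (p * q * r)
      Ψz≋E = ≋-trans (mk≋ (subst (λ n → Ψ *ₚ Φ n ≈ₚ xpow-1 (p * q * r)) (sym pqr≡) ΨΦ)) (xpow-1≋E 1≤pqr)

      z₀≢0 : coeff z 0 ≢ 0ℤ
      z₀≢0 z₀≡0 = E₀≢0 1≤pqr (trans (sym (at Ψz≋E 0))
        (trans (coeff-*-0 Ψ z) (trans (cong (coeff Ψ 0 ℤ.*_) z₀≡0) (ℤₚ.*-zeroʳ (coeff Ψ 0)))))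

      open ≋-Reasoning
      open PolySolver

      Ψ≋ : Ψ ≋ (a *ₚ (b *ₚ (c *ₚ (d *ₚ (e *ₚ (f *ₚ g))))))
      Ψ≋ = *ₚ-cancelˡ z z₀≢0 (begin
        z *ₚ Ψ             ≈⟨ *ₚ-comm z Ψ ⟩
        Ψ *ₚ z             ≈⟨ Ψz≋E ⟩
        E (p * q * r)      ≈⟨ E≡ (p * (q * (r * 1))) pqr≡ σpqr ⟩
        a *ₚ (b *ₚ (c *ₚ (d *ₚ (e *ₚ (f *ₚ (g *ₚ (z *ₚ oneₚ)))))))
          ≈⟨ solve 8 (λ a b c d e f g z →
                a :* (b :* (c :* (d :* (e :* (f :* (g :* (z :* con 1ℤ))))))) :=
                z :* (a :* (b :* (c :* (d :* (e :* (f :* g))))))) (λ {_} → ≋-refl) a b c d e f g z ⟩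
        z *ₚ (a *ₚ (b *ₚ (c *ₚ (d *ₚ (e *ₚ (f *ₚ g))))))    ∎)

    -- Möbius inversion for Φ_pqr with the denominators cleared: after factoring each x^n - 1, both
    -- sides are the same product a⁴ b² c² d e² f g.
    Ψ*EpEqEr : (Ψ *ₚ (E p *ₚ (E q *ₚ E r))) ≋ ((E (p * q) *ₚ E 1) *ₚ (E (p * r) *ₚ E (q * r)))
    Ψ*EpEqEr = begin
      Ψ *ₚ (E p *ₚ (E q *ₚ E r))
        ≈⟨ *ₚ-cong Ψ≋ (*ₚ-cong (E≡ (p * 1) (ℕₚ.*-identityʳ p) σp)
             (*ₚ-cong (E≡ (q * 1) (ℕₚ.*-identityʳ q) σq) (E≡ (r * 1) (ℕₚ.*-identityʳ r) σr))) ⟩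
      (a *ₚ (b *ₚ (c *ₚ (d *ₚ (e *ₚ (f *ₚ g)))))) *ₚ
        ((a *ₚ (e *ₚ oneₚ)) *ₚ ((a *ₚ (c *ₚ oneₚ)) *ₚ (a *ₚ (b *ₚ oneₚ))))
        ≈⟨ solve 7 (λ a b c d e f g →
              (a :* (b :* (c :* (d :* (e :* (f :* g)))))) :*
                ((a :* (e :* con 1ℤ)) :* ((a :* (c :* con 1ℤ)) :* (a :* (b :* con 1ℤ)))) :=
              ((a :* (c :* (e :* (g :* con 1ℤ)))) :* (a :* con 1ℤ)) :*
                ((a :* (b :* (e :* (f :* con 1ℤ)))) :* (a :* (b :* (c :* (d :* con 1ℤ))))))
             (λ {_} → ≋-refl) a b c d e f g ⟩
      ((a *ₚ (c *ₚ (e *ₚ (g *ₚ oneₚ)))) *ₚ (a *ₚ oneₚ)) *ₚ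
        ((a *ₚ (b *ₚ (e *ₚ (f *ₚ oneₚ)))) *ₚ (a *ₚ (b *ₚ (c *ₚ (d *ₚ oneₚ)))))
        ≈⟨ *ₚ-cong
             (*ₚ-cong (E≡ (p * (q * 1)) (cong (p *_) (ℕₚ.*-identityʳ q)) σpq) (E≡ 1 refl σ₁))
             (*ₚ-cong (E≡ (p * (r * 1)) (cong (p *_) (ℕₚ.*-identityʳ r)) σpr)
                      (E≡ (q * (r * 1)) (cong (q *_) (ℕₚ.*-identityʳ r)) σqr)) ⟨
      (E (p * q) *ₚ E 1) *ₚ (E (p * r) *ₚ E (q * r))    ∎

-- Coefficients of Φ_pq

∑ : ℕ → (ℕ → ℤ) → ℤ
∑ zero    f = 0ℤ
∑ (suc n) f = ∑ n f ℤ.+ f n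

∑-cong : ∀ n {f g} → (∀ i → i < n → f i ≡ g i) → ∑ n f ≡ ∑ n g
∑-cong zero    e = refl
∑-cong (suc n) e = cong₂ ℤ._+_ (∑-cong n λ i i<n → e i (ℕₚ.m<n⇒m<1+n i<n)) (e n (ℕₚ.n<1+n n))

∑-zero : ∀ n {f} → (∀ i → i < n → f i ≡ 0ℤ) → ∑ n f ≡ 0ℤ
∑-zero zero    e = refl
∑-zero (suc n) e = cong₂ ℤ._+_ (∑-zero n λ i i<n → e i (ℕₚ.m<n⇒m<1+n i<n)) (e n (ℕₚ.n<1+n n))

∑-+ : ∀ n f g → ∑ n (λ i → f i ℤ.+ g i) ≡ ∑ n f ℤ.+ ∑ n g
∑-+ zero    f g = refl
∑-+ (suc n) f g = trans (cong (ℤ._+ (f n ℤ.+ g n)) (∑-+ n f g)) (lemma (∑ n f) (∑ n g) (f n) (g n))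
  where
  lemma : ∀ a b c d → (a ℤ.+ b) ℤ.+ (c ℤ.+ d) ≡ (a ℤ.+ c) ℤ.+ (b ℤ.+ d)
  lemma = ℤSolver.solve-∀

∑-* : ∀ n c f → ∑ n (λ i → c ℤ.* f i) ≡ c ℤ.* ∑ n f
∑-* zero    c f = sym (ℤₚ.*-zeroʳ c)
∑-* (suc n) c f = trans (cong (ℤ._+ c ℤ.* f n) (∑-* n c f)) (sym (ℤₚ.*-distribˡ-+ c (∑ n f) (f n)))

∑-split : ∀ m n f → ∑ (m + n) f ≡ ∑ m f ℤ.+ ∑ n (λ i → f (m + i))
∑-split m zero    f = trans (cong (λ x → ∑ x f) (ℕₚ.+-identityʳ m)) (sym (ℤₚ.+-identityʳ _))
∑-split m (suc n) f = begin
  ∑ (m + suc n) f                                    ≡⟨ cong (λ x → ∑ x f) (ℕₚ.+-suc m n) ⟩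
  ∑ (m + n) f ℤ.+ f (m + n)                          ≡⟨ cong (ℤ._+ f (m + n)) (∑-split m n f) ⟩
  ∑ m f ℤ.+ ∑ n (λ i → f (m + i)) ℤ.+ f (m + n)      ≡⟨ ℤₚ.+-assoc (∑ m f) _ _ ⟩
  ∑ m f ℤ.+ ∑ (suc n) (λ i → f (m + i))              ∎
  where open ≡-Reasoning

∑-extend : ∀ {m n f} → m ≤ n → (∀ l → m ≤ l → l < n → f l ≡ 0ℤ) → ∑ n f ≡ ∑ m f
∑-extend {m} {n} {f} m≤n f≡0 = begin
  ∑ n f                                         ≡⟨ cong (λ x → ∑ x f) (ℕₚ.m+[n∸m]≡n m≤n) ⟨
  ∑ (m + (n ∸ m)) f                             ≡⟨ ∑-split m (n ∸ m) f ⟩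
  ∑ m f ℤ.+ ∑ (n ∸ m) (λ i → f (m + i))         ≡⟨ cong (ℤ._+_ (∑ m f)) (∑-zero (n ∸ m) λ i i< →
                                                     f≡0 (m + i) (ℕₚ.m≤m+n m i) (subst (m + i <_) (ℕₚ.m+[n∸m]≡n m≤n) (ℕₚ.+-monoʳ-< m i<))) ⟩
  ∑ m f ℤ.+ 0ℤ                                  ≡⟨ ℤₚ.+-identityʳ _ ⟩
  ∑ m f                                         ∎
  where open ≡-Reasoning

-- The bounds N and s + w are not comparable in general, so both sums are extended by zeros to the
-- common bound N + (s + w).
∑-window : ∀ N s w f → (∀ l → f l ≢ 0ℤ → l < N × s ≤ l × l < s + w) →
           ∑ N f ≡ ∑ w (λ m → f (s + m))
∑-window N s w f supp = begin
  ∑ N f                                      ≡⟨ ∑-extend (ℕₚ.m≤m+n N (s + w)) (λ l N≤l _ → outside l λ l≢ → ℕₚ.≤⇒≯ N≤l (proj₁ (supp l l≢))) ⟨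
  ∑ (N + (s + w)) f                          ≡⟨ ∑-extend (ℕₚ.m≤n+m (s + w) N) (λ l sw≤l _ → outside l λ l≢ → ℕₚ.≤⇒≯ sw≤l (proj₂ (proj₂ (supp l l≢)))) ⟩
  ∑ (s + w) f                                ≡⟨ ∑-split s w f ⟩
  ∑ s f ℤ.+ ∑ w (λ m → f (s + m))            ≡⟨ cong (ℤ._+ ∑ w (λ m → f (s + m))) (∑-zero s λ l l<s → outside l λ l≢ → ℕₚ.<⇒≱ l<s (proj₁ (proj₂ (supp l l≢)))) ⟩
  0ℤ ℤ.+ ∑ w (λ m → f (s + m))               ≡⟨ ℤₚ.+-identityˡ _ ⟩
  ∑ w (λ m → f (s + m))                      ∎
  where
  open ≡-Reasoning
  outside : ∀ l → ¬ f l ≢ 0ℤ → f l ≡ 0ℤ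
  outside l = decidable-stable (f l ℤₚ.≟ 0ℤ)

∑-≤ : ∀ n f → (∀ i → i < n → f i ℤ.≤ 1ℤ) → ∑ n f ℤ.≤ + n
∑-≤ zero    f f≤1 = ℤₚ.≤-refl
∑-≤ (suc n) f f≤1 = subst (∑ (suc n) f ℤ.≤_) (cong +_ (ℕₚ.+-comm n 1))
  (ℤₚ.+-mono-≤ (∑-≤ n f λ i i<n → f≤1 i (ℕₚ.m<n⇒m<1+n i<n)) (f≤1 n (ℕₚ.n<1+n n)))

-- The equality case of `∑-≤`: a last term other than 1 would be less than 1, and the n terms before
-- it cannot make up for the loss.
∑-max : ∀ n f → (∀ i → i < n → f i ℤ.≤ 1ℤ) → ∑ n f ≡ + n → ∀ i → i < n → f i ≡ 1ℤ
∑-max (suc n) f f≤1 ∑≡ i i<1+n = go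
  where
  f≤1′ : ∀ i → i < n → f i ℤ.≤ 1ℤ
  f≤1′ i i<n = f≤1 i (ℕₚ.m<n⇒m<1+n i<n)
  ∑≡′ : ∑ n f ℤ.+ f n ≡ + n ℤ.+ 1ℤ
  ∑≡′ = trans ∑≡ (cong +_ (ℕₚ.+-comm 1 n))
  fn≡1 : f n ≡ 1ℤ
  fn≡1 with f n ℤₚ.≟ 1ℤ
  ... | yes e = e
  ... | no ≢1 = contradiction ∑≡′ (ℤₚ.<⇒≢ (ℤₚ.+-mono-≤-< (∑-≤ n f f≤1′) (ℤₚ.≤∧≢⇒< (f≤1 n (ℕₚ.n<1+n n)) ≢1)))
  go : f i ≡ 1ℤ
  go with ℕₚ.m≤n⇒m<n∨m≡n (ℕ.s≤s⁻¹ i<1+n)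
  ... | inj₂ refl = fn≡1
  ... | inj₁ i<n  = ∑-max n f f≤1′ (∙-cancelʳ 1ℤ _ _ (trans (cong (ℤ._+_ (∑ n f)) (sym fn≡1)) ∑≡′)) i i<n

∑-01 : ∀ n f → (∀ i → i < n → f i ≡ 0ℤ ⊎ f i ≡ 1ℤ) →
       (∀ i j → i < n → j < n → f i ≡ 1ℤ → f j ≡ 1ℤ → i ≡ j) →
       ∑ n f ≡ 0ℤ ⊎ (∑ n f ≡ 1ℤ × (∃[ i ] (i < n) × (f i ≡ 1ℤ)))
∑-01 zero    f f01 inj = inj₁ refl
∑-01 (suc n) f f01 inj
  with f01 n (ℕₚ.n<1+n n)
     | ∑-01 n f (λ i i<n → f01 i (ℕₚ.m<n⇒m<1+n i<n))
         (λ i j i<n j<n → inj i j (ℕₚ.m<n⇒m<1+n i<n) (ℕₚ.m<n⇒m<1+n j<n))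
... | inj₁ fn≡0 | inj₁ ∑≡0                    = inj₁ (cong₂ ℤ._+_ ∑≡0 fn≡0)
... | inj₁ fn≡0 | inj₂ (∑≡1 , i , i<n , fi≡1) = inj₂ (cong₂ ℤ._+_ ∑≡1 fn≡0 , i , ℕₚ.m<n⇒m<1+n i<n , fi≡1)
... | inj₂ fn≡1 | inj₁ ∑≡0                    = inj₂ (cong₂ ℤ._+_ ∑≡0 fn≡1 , n , ℕₚ.n<1+n n , fn≡1)
... | inj₂ fn≡1 | inj₂ (_ , i , i<n , fi≡1)   =
  contradiction (inj i n (ℕₚ.m<n⇒m<1+n i<n) (ℕₚ.n<1+n n) fi≡1 fn≡1) (ℕₚ.<⇒≢ i<n)

-- Products of geometric sums with coefficients 0 and 1

coeff-geom-* : ∀ s u f k → coeff (geom s u *ₚ f) k ≡ ∑ u (λ i → coeff (X^ (i * s) *ₚ f) k)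
coeff-geom-* s zero    f k = refl
coeff-geom-* s (suc u) f k = begin
  coeff ((geom s u +ₚ X^ (u * s)) *ₚ f) k                      ≡⟨ at (*ₚ-distribʳ f (geom s u) _) k ⟩
  coeff ((geom s u *ₚ f) +ₚ (X^ (u * s) *ₚ f)) k               ≡⟨ coeff-+ (geom s u *ₚ f) _ k ⟩
  coeff (geom s u *ₚ f) k ℤ.+ coeff (X^ (u * s) *ₚ f) k        ≡⟨ cong (ℤ._+ coeff (X^ (u * s) *ₚ f) k) (coeff-geom-* s u f k) ⟩
  ∑ (suc u) (λ i → coeff (X^ (i * s) *ₚ f) k)                  ∎
  where open ≡-Reasoning

coeff-X^* : ∀ n f k → coeff (X^ n *ₚ f) k ≡ 0ℤ ⊎ (∃[ m ] (k ≡ n + m) × (coeff (X^ n *ₚ f) k ≡ coeff f m))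
coeff-X^* n f k with coeff (X^ n *ₚ f) k ℤₚ.≟ 0ℤ
... | yes e = inj₁ e
... | no ≢0 = inj₂ (coeff-X^-≢0 n f k ≢0)

≡1⇒≢0 : ∀ {i} → i ≡ 1ℤ → i ≢ 0ℤ
≡1⇒≢0 refl ()

coeff-X^*-1 : ∀ n f k → coeff (X^ n *ₚ f) k ≡ 1ℤ → ∃[ m ] (k ≡ n + m) × (coeff f m ≡ 1ℤ)
coeff-X^*-1 n f k e with coeff-X^-≢0 n f k (≡1⇒≢0 e)
... | m , k≡ , e′ = m , k≡ , trans (sym e′) e

-- By the injectivity hypothesis at most one shift of `f` by a multiple of s contributes at k.
-- Applied with `f` the constant 1 and then with `f` a geometric sum, this handles the products in
-- `binary`.
coeff-geom-*-01 : ∀ s u f k → (∀ m → coeff f m ≡ 0ℤ ⊎ coeff f m ≡ 1ℤ) →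
  (∀ i j m n → i < u → j < u → coeff f m ≡ 1ℤ → coeff f n ≡ 1ℤ → i * s + m ≡ j * s + n → i ≡ j) →
  coeff (geom s u *ₚ f) k ≡ 0ℤ ⊎
  (coeff (geom s u *ₚ f) k ≡ 1ℤ × (∃[ i ] ∃[ m ] (i < u) × (k ≡ i * s + m) × (coeff f m ≡ 1ℤ)))
coeff-geom-*-01 s u f k f01 inj with ∑-01 u (λ i → coeff (X^ (i * s) *ₚ f) k) term-01 term-inj
  where
  term-01 : ∀ i → i < u → coeff (X^ (i * s) *ₚ f) k ≡ 0ℤ ⊎ coeff (X^ (i * s) *ₚ f) k ≡ 1ℤ
  term-01 i _ with coeff-X^* (i * s) f k
  ... | inj₁ e = inj₁ e
  ... | inj₂ (m , _ , e) with f01 m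
  ...   | inj₁ e′ = inj₁ (trans e e′)
  ...   | inj₂ e′ = inj₂ (trans e e′)
  term-inj : ∀ i j → i < u → j < u →
    coeff (X^ (i * s) *ₚ f) k ≡ 1ℤ → coeff (X^ (j * s) *ₚ f) k ≡ 1ℤ → i ≡ j
  term-inj i j i<u j<u ei ej with coeff-X^*-1 (i * s) f k ei | coeff-X^*-1 (j * s) f k ej
  ... | m , k≡ , em | n , k≡′ , en = inj i j m n i<u j<u em en (trans (sym k≡) k≡′)
... | inj₁ e = inj₁ (trans (coeff-geom-* s u f k) e)
... | inj₂ (e , i , i<u , ei) with coeff-X^*-1 (i * s) f k ei
...   | m , k≡ , em = inj₂ (trans (coeff-geom-* s u f k) e , i , m , i<u , k≡ , em)

geom*one : ∀ s u → (geom s u *ₚ oneₚ) ≋ geom s u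
geom*one s u = ≋-trans (*ₚ-comm (geom s u) oneₚ) (*ₚ-identityˡ (geom s u))

coeff-geom : ∀ q v .{{_ : NonZero q}} k →
             coeff (geom q v) k ≡ 0ℤ ⊎ (coeff (geom q v) k ≡ 1ℤ × (∃[ j ] (j < v) × (k ≡ j * q)))
coeff-geom q v k with coeff-geom-*-01 q v oneₚ k one-01 inj
  where
  one-01 : ∀ k → coeff oneₚ k ≡ 0ℤ ⊎ coeff oneₚ k ≡ 1ℤ
  one-01 zero    = inj₂ refl
  one-01 (suc k) = inj₁ refl
  one-1 : ∀ k → coeff oneₚ k ≡ 1ℤ → k ≡ 0
  one-1 zero _ = refl
  inj : ∀ i j m n → i < v → j < v → coeff oneₚ m ≡ 1ℤ → coeff oneₚ n ≡ 1ℤ → i * q + m ≡ j * q + n → i ≡ j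
  inj i j m n _ _ em en e = ℕₚ.*-cancelʳ-≡ i j q (ℕₚ.+-cancelʳ-≡ 0 _ _
    (subst₂ (λ m n → i * q + m ≡ j * q + n) (one-1 m em) (one-1 n en) e))
... | inj₁ e = inj₁ (trans (sym (at (geom*one q v) k)) e)
... | inj₂ (e , j , zero , j<v , k≡ , _) =
  inj₂ (trans (sym (at (geom*one q v) k)) e , j , j<v , trans k≡ (ℕₚ.+-identityʳ (j * q)))

-- Subtracting the two representations gives q ∣ p (i′ - i), hence q ∣ i′ - i by coprimality, while
-- i′ - i < q.
representation-≤ : ∀ {p q} → Coprime q p → ∀ {i i′} j j′ → i ≤ i′ → i′ < q →
                   i * p + j * q ≡ i′ * p + j′ * q → i ≡ i′
representation-≤ {p} {q} q⊥p {i} {i′} j j′ i≤i′ i′<q e = go (ℕₚ.m≤n⇒∃[o]m+o≡n i≤i′)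
  where
  go : (∃[ d ] i + d ≡ i′) → i ≡ i′
  go (zero  , refl) = sym (ℕₚ.+-identityʳ i)
  go (suc d , refl) = contradiction (∣⇒≤ (coprime-divisor {m = q} {n = p} q⊥p q∣pd))
    (ℕₚ.<⇒≱ (ℕₚ.≤-<-trans (ℕₚ.m≤n+m (suc d) i) i′<q))
    where
    jq≡ : j * q ≡ p * suc d + j′ * q
    jq≡ = ℕₚ.+-cancelˡ-≡ (i * p) _ _ (begin
      i * p + j * q                    ≡⟨ e ⟩
      (i + suc d) * p + j′ * q         ≡⟨ cong (_+ j′ * q) (ℕₚ.*-distribʳ-+ p i (suc d)) ⟩
      i * p + suc d * p + j′ * q       ≡⟨ ℕₚ.+-assoc (i * p) _ _ ⟩
      i * p + (suc d * p + j′ * q)     ≡⟨ cong (λ x → i * p + (x + j′ * q)) (ℕₚ.*-comm (suc d) p) ⟩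
      i * p + (p * suc d + j′ * q)     ∎)
      where open ≡-Reasoning
    q∣pd : q ∣ p * suc d
    q∣pd = ∣m+n∣m⇒∣n (subst (q ∣_) (trans jq≡ (ℕₚ.+-comm (p * suc d) _)) (n∣m*n j)) (n∣m*n j′)

representation-unique : ∀ {p q} → Coprime q p → ∀ {i i′} j j′ → i < q → i′ < q →
                        i * p + j * q ≡ i′ * p + j′ * q → i ≡ i′
representation-unique q⊥p {i} {i′} j j′ i<q i′<q e with ℕₚ.≤-total i i′
... | inj₁ i≤i′ = representation-≤ q⊥p j j′ i≤i′ i′<q e
... | inj₂ i′≤i = sym (representation-≤ q⊥p j′ j i′≤i i<q (sym e))

coeff-geom-geom : ∀ {p q} u v .{{_ : NonZero q}} → Coprime q p → u ≤ q → ∀ k →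
                  coeff (geom p u *ₚ geom q v) k ≡ 0ℤ ⊎
                  (coeff (geom p u *ₚ geom q v) k ≡ 1ℤ ×
                   (∃[ i ] ∃[ j ] (i < u) × (j < v) × (k ≡ i * p + j * q)))
coeff-geom-geom {p} {q} u v q⊥p u≤q k with coeff-geom-*-01 p u (geom q v) k G-01 inj
  where
  G-01 : ∀ m → coeff (geom q v) m ≡ 0ℤ ⊎ coeff (geom q v) m ≡ 1ℤ
  G-01 m with coeff-geom q v m
  ... | inj₁ e       = inj₁ e
  ... | inj₂ (e , _) = inj₂ e
  inj : ∀ i j m n → i < u → j < u → coeff (geom q v) m ≡ 1ℤ → coeff (geom q v) n ≡ 1ℤ →
        i * p + m ≡ j * p + n → i ≡ j
  inj i j m n i<u j<u em en e with coeff-geom q v m | coeff-geom q v n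
  ... | inj₁ e₀ | _       = contradiction e₀ (≡1⇒≢0 em)
  ... | inj₂ _  | inj₁ e₀ = contradiction e₀ (≡1⇒≢0 en)
  ... | inj₂ (_ , a , _ , refl) | inj₂ (_ , b , _ , refl) =
    representation-unique q⊥p a b (ℕₚ.<-≤-trans i<u u≤q) (ℕₚ.<-≤-trans j<u u≤q) e
... | inj₁ e = inj₁ e
... | inj₂ (e , i , m , i<u , k≡ , em) with coeff-geom q v m
...   | inj₁ e₀                    = contradiction e₀ (≡1⇒≢0 em)
...   | inj₂ (_ , j , j<v , refl) = inj₂ (e , i , j , i<u , j<v , k≡)

coeff-- : ∀ f g k → coeff (f +ₚ (-ₚ g)) k ≡ coeff f k ℤ.- coeff g k
coeff-- f g k = trans (coeff-+ f (-ₚ g) k)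
  (cong (ℤ._+_ (coeff f k)) (trans (coeff-scale -1ℤ g k) (ℤₚ.-1*i≡-i (coeff g k))))

-- The exponents n at which the coefficient of Φ_pq is ε, when v q ≡ 1 + t p, u = q - t and w = p - v.
data Exponent (p q u v t w n : ℕ) : ℤ → Set where
  pos : ∀ {i j} → i < u → j < v → n ≡ i * p + j * q → Exponent p q u v t w n 1ℤ
  neg : ∀ {i j} → i < t → j < w → n ≡ 1 + (i * p + j * q) → Exponent p q u v t w n -1ℤ

coeff-binary : ∀ {p q} u v t w .{{_ : NonZero q}} → Coprime q p → u ≤ q → t ≤ q → ∀ n →
               coeff (binary p q u v t w) n ≡ 0ℤ ⊎ Exponent p q u v t w n (coeff (binary p q u v t w) n)
coeff-binary {p} {q} u v t w q⊥p u≤q t≤q n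
  rewrite coeff-- (geom p u *ₚ geom q v) (X^ 1 *ₚ (geom p t *ₚ geom q w)) n
  with coeff-geom-geom u v q⊥p u≤q n | coeff-X^* 1 (geom p t *ₚ geom q w) n
... | inj₁ e | inj₁ e′ rewrite e | e′ = inj₁ refl
... | inj₂ (e , i , j , i<u , j<v , n≡) | inj₁ e′ rewrite e | e′ = inj₂ (pos i<u j<v n≡)
... | x | inj₂ (m , n≡1+m , e′) with x | coeff-geom-geom t w q⊥p t≤q m
...   | inj₁ e | inj₁ e″ rewrite e | e′ | e″ = inj₁ refl
...   | inj₁ e | inj₂ (e″ , i , j , i<t , j<w , m≡) rewrite e | e′ | e″ =
  inj₂ (neg i<t j<w (trans n≡1+m (cong suc m≡)))
...   | inj₂ (e , i , j , i<u , j<v , n≡) | inj₁ e″ rewrite e | e′ | e″ = inj₂ (pos i<u j<v n≡)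
-- Both products contribute here, and 1 - 1 = 0 falls under the first alternative.
...   | inj₂ (e , _) | inj₂ (e″ , _) rewrite e | e′ | e″ = inj₁ refl

-- Coefficients of Ψ_pqr

-- Indexed by the integer, so that matching turns it into a literal and products compute.
data Trit : ℤ → Set where
  0ᵗ : Trit 0ℤ
  1ᵗ : Trit 1ℤ
  -ᵗ : Trit -1ℤ

*-trit : ∀ {i j} → Trit i → Trit j → Trit (i ℤ.* j)
*-trit 0ᵗ 0ᵗ = 0ᵗ
*-trit 0ᵗ 1ᵗ = 0ᵗ
*-trit 0ᵗ -ᵗ = 0ᵗ
*-trit 1ᵗ 0ᵗ = 0ᵗ
*-trit 1ᵗ 1ᵗ = 1ᵗ
*-trit 1ᵗ -ᵗ = -ᵗ
*-trit -ᵗ 0ᵗ = 0ᵗ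
*-trit -ᵗ 1ᵗ = -ᵗ
*-trit -ᵗ -ᵗ = 1ᵗ

trit≤1 : ∀ {i} → Trit i → i ℤ.≤ 1ℤ
trit≤1 0ᵗ = +≤+ z≤n
trit≤1 1ᵗ = ℤₚ.≤-refl
trit≤1 -ᵗ = -≤+

trit-inverse : ∀ {i j} → Trit i → Trit j → i ℤ.* j ≡ 1ℤ → j ≡ i
trit-inverse 1ᵗ 1ᵗ _ = refl
trit-inverse -ᵗ -ᵗ _ = refl
trit-inverse 0ᵗ 0ᵗ ()
trit-inverse 0ᵗ 1ᵗ ()
trit-inverse 0ᵗ -ᵗ ()
trit-inverse 1ᵗ 0ᵗ ()
trit-inverse 1ᵗ -ᵗ ()
trit-inverse -ᵗ 0ᵗ ()
trit-inverse -ᵗ 1ᵗ ()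

*-≢0ˡ : ∀ i j → i ℤ.* j ≢ 0ℤ → i ≢ 0ℤ
*-≢0ˡ i j ij≢0 refl = ij≢0 (ℤₚ.*-zeroˡ j)

*-≢0ʳ : ∀ i j → i ℤ.* j ≢ 0ℤ → j ≢ 0ℤ
*-≢0ʳ i j ij≢0 refl = ij≢0 (ℤₚ.*-zeroʳ i)

sign-split : ∀ i → ∃[ ε ] Trit ε × (ε ℤ.* i ≡ + ∣ i ∣)
sign-split (+ n)    = 1ℤ , 1ᵗ , ℤₚ.*-identityˡ (+ n)
sign-split -[1+ n ] = -1ℤ , -ᵗ , ℤₚ.-1*i≡-i -[1+ n ]

module _ {p q : ℕ} (p<q : p < q) where

  -- The coefficients of Ψ_pq = (x^q - 1)(1 + x + ⋯ + x^(p-1)).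
  χ : ℕ → ℤ
  χ l with l <? p
  ... | yes _ = -1ℤ
  ... | no _ with l <? q
  ...   | yes _ = 0ℤ
  ...   | no _ with l <? q + p
  ...     | yes _ = 1ℤ
  ...     | no _  = 0ℤ

  χ-trit : ∀ l → Trit (χ l)
  χ-trit l with l <? p
  ... | yes _ = -ᵗ
  ... | no _ with l <? q
  ...   | yes _ = 0ᵗ
  ...   | no _ with l <? q + p
  ...     | yes _ = 1ᵗ
  ...     | no _  = 0ᵗ

  χ-low : ∀ {l} → l < p → χ l ≡ -1ℤ
  χ-low {l} l<p with l <? p
  ... | yes _  = refl
  ... | no l≮p = contradiction l<p l≮p

  χ-middle : ∀ {l} → p ≤ l → l < q → χ l ≡ 0ℤ
  χ-middle {l} p≤l l<q with l <? p
  ... | yes l<p = contradiction p≤l (ℕₚ.<⇒≱ l<p)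
  ... | no _ with l <? q
  ...   | yes _  = refl
  ...   | no l≮q = contradiction l<q l≮q

  χ-high : ∀ {l} → p ≤ l → q ≤ l → l < q + p → χ l ≡ 1ℤ
  χ-high {l} p≤l q≤l l<q+p with l <? p
  ... | yes l<p = contradiction p≤l (ℕₚ.<⇒≱ l<p)
  ... | no _ with l <? q
  ...   | yes l<q = contradiction q≤l (ℕₚ.<⇒≱ l<q)
  ...   | no _ with l <? q + p
  ...     | yes _    = refl
  ...     | no l≮q+p = contradiction l<q+p l≮q+p

  χ-≢0 : ∀ {l} → χ l ≢ 0ℤ →
         (l < p × χ l ≡ -1ℤ) ⊎ (q ≤ l × l < q + p × χ l ≡ 1ℤ)
  χ-≢0 {l} χ≢0 with l <? p
  ... | yes l<p = inj₁ (l<p , refl)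
  ... | no _ with l <? q
  ...   | yes _ = contradiction refl χ≢0
  ...   | no l≮q with l <? q + p
  ...     | yes l<q+p = inj₂ (ℕₚ.≮⇒≥ l≮q , l<q+p , refl)
  ...     | no _      = contradiction refl χ≢0

  χ-<q+p : ∀ {l} → χ l ≢ 0ℤ → l < q + p
  χ-<q+p χ≢0 with χ-≢0 χ≢0
  ... | inj₁ (l<p , _)       = ℕₚ.<-≤-trans l<p (ℕₚ.m≤n+m p q)
  ... | inj₂ (_ , l<q+p , _) = l<q+p

  -- A change of sign between neighbours would have to jump over the zeros on [p, q), of which there
  -- is at least one because p < q.
  χ-suc : ∀ {l} → χ l ≢ 0ℤ → χ (suc l) ≢ 0ℤ → χ (suc l) ≡ χ l
  χ-suc χ≢0 χ≢0′ with χ-≢0 χ≢0 | χ-≢0 χ≢0′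
  ... | inj₁ (_ , e)      | inj₁ (_ , e′)           = trans e′ (sym e)
  ... | inj₁ (l<p , _)    | inj₂ (q≤1+l , _)        = contradiction (ℕₚ.≤-trans q≤1+l l<p) (ℕₚ.<⇒≱ p<q)
  ... | inj₂ (q≤l , _)    | inj₁ (1+l<p , _)        =
    contradiction (ℕₚ.<-trans (ℕₚ.≤-<-trans (ℕₚ.m≤n⇒m≤1+n q≤l) 1+l<p) p<q) (ℕₚ.<-irrefl refl)
  ... | inj₂ (_ , _ , e)  | inj₂ (_ , _ , e′)       = trans e′ (sym e)

  χ-run : ∀ w s → (∀ m → m < w → χ (s + m) ≢ 0ℤ) →
          ∀ m → m < w → χ (s + m) ≡ χ s
  χ-run w s χ≢0 zero    _ = cong χ (ℕₚ.+-identityʳ s)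
  χ-run w s χ≢0 (suc m) 1+m<w = begin
    χ (s + suc m)    ≡⟨ cong χ (ℕₚ.+-suc s m) ⟩
    χ (suc (s + m))  ≡⟨ χ-suc (χ≢0 m m<w) (subst (λ l → χ l ≢ 0ℤ) (ℕₚ.+-suc s m) (χ≢0 (suc m) 1+m<w)) ⟩
    χ (s + m)        ≡⟨ χ-run w s χ≢0 m m<w ⟩
    χ s              ∎
    where
    open ≡-Reasoning
    m<w : m < w
    m<w = ℕₚ.<-trans (ℕₚ.n<1+n m) 1+m<w

  -- The blocks [0, p) and [q, q + p) are merged into one weighted sum over consecutive l, to which
  -- a window of consecutive indices can be applied.
  ∑-χ : ∀ (g : ℕ → ℤ) → ∑ p (λ l → g (q + l) ℤ.- g l) ≡ ∑ (q + p) (λ l → χ l ℤ.* g l)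
  ∑-χ g = begin
    ∑ p (λ l → g (q + l) ℤ.- g l)             ≡⟨ ∑-cong p term ⟩
    ∑ p (λ l → f l ℤ.+ f (q + l))             ≡⟨ ∑-+ p f (λ l → f (q + l)) ⟩
    ∑ p f ℤ.+ ∑ p (λ l → f (q + l))           ≡⟨ cong (ℤ._+ ∑ p (λ l → f (q + l))) (∑-extend (ℕₚ.<⇒≤ p<q) f-middle) ⟨
    ∑ q f ℤ.+ ∑ p (λ l → f (q + l))           ≡⟨ ∑-split q p f ⟨
    ∑ (q + p) f                               ∎
    where
    open ≡-Reasoning
    f : ℕ → ℤ
    f l = χ l ℤ.* g l
    f-middle : ∀ l → p ≤ l → l < q → f l ≡ 0ℤ
    f-middle l p≤l l<q = trans (cong (ℤ._* g l) (χ-middle p≤l l<q)) (ℤₚ.*-zeroˡ (g l))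
    lemma : ∀ a b → a ℤ.- b ≡ -1ℤ ℤ.* b ℤ.+ 1ℤ ℤ.* a
    lemma = ℤSolver.solve-∀
    term : ∀ l → l < p → g (q + l) ℤ.- g l ≡ f l ℤ.+ f (q + l)
    term l l<p = trans (lemma (g (q + l)) (g l)) (cong₂ (λ x y → x ℤ.* g l ℤ.+ y ℤ.* g (q + l))
      (sym (χ-low l<p))
      (sym (χ-high (ℕₚ.≤-trans (ℕₚ.<⇒≤ p<q) (ℕₚ.m≤m+n q l)) (ℕₚ.m≤m+n q l) (ℕₚ.+-monoʳ-< q l<p))))

  -- Multiplied by the sign σ of the sum, the w terms in the window are each at most 1 and add up to
  -- w, so each equals 1. None of the weights χ is then zero, so they share one value, and g has the
  -- constant value σ χ(s) there.
  extremal-run : ∀ w s (g : ℕ → ℤ) → (∀ l → Trit (g l)) →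
                 (∀ l → g l ≢ 0ℤ → s ≤ l × l < s + w) →
                 ∣ ∑ p (λ l → g (q + l) ℤ.- g l) ∣ ≡ w →
                 ∃[ ε ] (∀ m → m < w → g (s + m) ≡ ε × ε ≢ 0ℤ)
  extremal-run w s g g-trit supp ∣c∣≡w with sign-split (∑ p (λ l → g (q + l) ℤ.- g l))
  ... | σ , σ-trit , σc = σ ℤ.* χ s , λ m m<w → g≡ m m<w , subst (_≢ 0ℤ) (g≡ m m<w) (g≢0 m m<w)
    where
    f : ℕ → ℤ
    f l = χ l ℤ.* g l
    f-supp : ∀ l → f l ≢ 0ℤ → l < q + p × s ≤ l × l < s + w
    f-supp l fl≢0 = χ-<q+p (*-≢0ˡ (χ l) (g l) fl≢0) , supp l (*-≢0ʳ (χ l) (g l) fl≢0)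
    σ∑≡w : ∑ w (λ m → σ ℤ.* f (s + m)) ≡ + w
    σ∑≡w = begin
      ∑ w (λ m → σ ℤ.* f (s + m))                        ≡⟨ ∑-* w σ (λ m → f (s + m)) ⟩
      σ ℤ.* ∑ w (λ m → f (s + m))                        ≡⟨ cong (σ ℤ.*_) (∑-window (q + p) s w f f-supp) ⟨
      σ ℤ.* ∑ (q + p) f                                  ≡⟨ cong (σ ℤ.*_) (∑-χ g) ⟨
      σ ℤ.* ∑ p (λ l → g (q + l) ℤ.- g l)                ≡⟨ trans σc (cong +_ ∣c∣≡w) ⟩
      + w                                                ∎
      where open ≡-Reasoning
    σf≡1 : ∀ m → m < w → σ ℤ.* f (s + m) ≡ 1ℤ
    σf≡1 = ∑-max w (λ m → σ ℤ.* f (s + m))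
      (λ m _ → trit≤1 (*-trit σ-trit (*-trit (χ-trit (s + m)) (g-trit (s + m))))) σ∑≡w
    f≢0 : ∀ m → m < w → f (s + m) ≢ 0ℤ
    f≢0 m m<w = *-≢0ʳ σ (f (s + m)) (≡1⇒≢0 (σf≡1 m m<w))
    g≢0 : ∀ m → m < w → g (s + m) ≢ 0ℤ
    g≢0 m m<w = *-≢0ʳ (χ (s + m)) (g (s + m)) (f≢0 m m<w)
    χ-const : ∀ m → m < w → χ (s + m) ≡ χ s
    χ-const = χ-run w s λ m m<w → *-≢0ˡ (χ (s + m)) (g (s + m)) (f≢0 m m<w)
    g≡ : ∀ m → m < w → g (s + m) ≡ σ ℤ.* χ s
    g≡ m m<w = trans
      (trit-inverse (*-trit σ-trit (χ-trit (s + m))) (g-trit (s + m))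
        (trans (ℤₚ.*-assoc σ (χ (s + m)) (g (s + m))) (σf≡1 m m<w)))
      (cong (σ ℤ.*_) (χ-const m m<w))

height-attained : ∀ f → height f ≢ 0 → ∃[ k ] ∣ coeff f k ∣ ≡ height f
height-attained []      h≢0 = contradiction refl h≢0
height-attained (a ∷ f) h≢0 with ℕₚ.⊔-sel ∣ a ∣ (height f)
... | inj₁ e = 0 , sym e
... | inj₂ e with height-attained f (subst (_≢ 0) e h≢0)
...   | k , e′ = suc k , trans e′ (sym e)

-- Ψ_pqr(x) = Ψ_pq(x^r) Φ_pq(x).
inverse-ternary : ∀ p q r {A Ψ} → 1 ≤ p → 1 ≤ q → 1 ≤ r →
  ((A *ₚ E p) *ₚ E q) ≋ (E (p * q) *ₚ E 1) →
  (Ψ *ₚ (E p *ₚ (E q *ₚ E r))) ≋ ((E (p * q) *ₚ E 1) *ₚ (E (p * r) *ₚ E (q * r))) →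
  Ψ ≋ (geom r p *ₚ (E (q * r) *ₚ A))
inverse-ternary p q r {A} {Ψ} 1≤p 1≤q 1≤r hA hΨ =
  *ₚ-cancelˡ (E p) (E₀≢0 1≤p) (*ₚ-cancelˡ (E q) (E₀≢0 1≤q) (*ₚ-cancelˡ (E r) (E₀≢0 1≤r) (begin
    E r *ₚ (E q *ₚ (E p *ₚ Ψ))
      ≈⟨ solve 4 (λ a b c d → c :* (b :* (a :* d)) := d :* (a :* (b :* c))) (λ {_} → ≋-refl) (E p) (E q) (E r) Ψ ⟩
    Ψ *ₚ (E p *ₚ (E q *ₚ E r))                             ≈⟨ hΨ ⟩
    (E (p * q) *ₚ E 1) *ₚ (E (p * r) *ₚ E (q * r))
      ≈⟨ *ₚ-cong hA (*ₚ-cong (E*geom r p) (≋-refl {E (q * r)})) ⟨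
    ((A *ₚ E p) *ₚ E q) *ₚ ((E r *ₚ geom r p) *ₚ E (q * r))
      ≈⟨ solve 6 (λ a b c d e f →
           ((d :* a) :* b) :* ((c :* e) :* f) := c :* (b :* (a :* (e :* (f :* d))))) (λ {_} → ≋-refl)
           (E p) (E q) (E r) A (geom r p) (E (q * r)) ⟩
    E r *ₚ (E q *ₚ (E p *ₚ (geom r p *ₚ (E (q * r) *ₚ A))))    ∎)))
  where
  open ≋-Reasoning
  open PolySolver

-- The factor x^(qr) - 1 turns each summand x^(lr) of the geometric sum into a difference of two
-- shifts, by (q + l) r and by l r.
coeff-inverse-ternary : ∀ p q r A k →
  coeff (geom r p *ₚ (E (q * r) *ₚ A)) k ≡
  ∑ p (λ l → coeff (X^ ((q + l) * r) *ₚ A) k ℤ.- coeff (X^ (l * r) *ₚ A) k)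
coeff-inverse-ternary p q r A k = trans (coeff-geom-* r p (E (q * r) *ₚ A) k) (∑-cong p λ l _ → term l)
  where
  open PolySolver
  shift : ∀ l → (X^ (l * r) *ₚ (E (q * r) *ₚ A)) ≋
                ((X^ ((q + l) * r) *ₚ A) +ₚ (-ₚ (X^ (l * r) *ₚ A)))
  shift l = begin
    X^ (l * r) *ₚ (E (q * r) *ₚ A)
      ≈⟨ solve 3 (λ x y a → x :* ((y :+ :- con 1ℤ) :* a) := (y :* x) :* a :+ :- (x :* a)) (λ {_} → ≋-refl)
           (X^ (l * r)) (X^ (q * r)) A ⟩
    ((X^ (q * r) *ₚ X^ (l * r)) *ₚ A) +ₚ (-ₚ (X^ (l * r) *ₚ A))
      ≈⟨ +ₚ-cong (*ₚ-cong (X^-+ (q * r) (l * r)) (≋-refl {A})) ≋-refl ⟩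
    (X^ (q * r + l * r) *ₚ A) +ₚ (-ₚ (X^ (l * r) *ₚ A))
      ≡⟨ cong (λ n → (X^ n *ₚ A) +ₚ (-ₚ (X^ (l * r) *ₚ A))) (ℕₚ.*-distribʳ-+ r q l) ⟨
    (X^ ((q + l) * r) *ₚ A) +ₚ (-ₚ (X^ (l * r) *ₚ A))    ∎
    where open ≋-Reasoning
  term : ∀ l → coeff (X^ (l * r) *ₚ (E (q * r) *ₚ A)) k ≡
               coeff (X^ ((q + l) * r) *ₚ A) k ℤ.- coeff (X^ (l * r) *ₚ A) k
  term l = trans (at (shift l) k) (coeff-- (X^ ((q + l) * r) *ₚ A) (X^ (l * r) *ₚ A) k)

-- Long runs of equal coefficients of Φ_pq

-- The parameters of `binary`: v is the inverse of q modulo p in [1, p - 1], t the quotient (v q -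
-- 1) / p, and w = p - v.
record ModularInverse (p q : ℕ) : Set where
  constructor inverse
  field
    v t w : ℕ
    1≤v : 1 ≤ v
    1≤w : 1 ≤ w
    v+w≡p : v + w ≡ p
    vq≡1+tp : v * q ≡ 1 + t * p

reduce-inverse : ∀ {p q} .{{_ : NonZero p}} X Y → 1 < p → X * q ≡ 1 + Y * p → ModularInverse p q
reduce-inverse {p} {q} X Y 1<p Xq≡ = inverse (X % p) (Y ∸ z * q) (p ∸ X % p)
  (1≤v (X % p) v*q≡) (ℕₚ.m<n⇒0<n∸m (m%n<n X p)) (ℕₚ.m+[n∸m]≡n (ℕₚ.<⇒≤ (m%n<n X p))) v*q≡
  where
  z = X / p
  v = X % p
  split : v * q + z * q * p ≡ 1 + Y * p
  split = begin
    v * q + z * q * p      ≡⟨ lemma v q z p ⟩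
    (v + z * p) * q        ≡⟨ cong (_* q) (m≡m%n+[m/n]*n X p) ⟨
    X * q                  ≡⟨ Xq≡ ⟩
    1 + Y * p              ∎
    where
    open ≡-Reasoning
    lemma : ∀ v q z p → v * q + z * q * p ≡ (v + z * p) * q
    lemma = ℕSolver.solve-∀
  -- Otherwise (Y + 1) p ≤ z q p ≤ 1 + Y p, against 1 < p.
  zq≤Y : z * q ≤ Y
  zq≤Y = ℕₚ.≮⇒≥ λ Y<zq → ℕₚ.<⇒≱ (ℕₚ.+-monoˡ-< (Y * p) 1<p)
    (ℕₚ.≤-trans (ℕₚ.*-monoˡ-≤ p Y<zq) (ℕₚ.≤-trans (ℕₚ.m≤n+m (z * q * p) (v * q)) (ℕₚ.≤-reflexive split)))
  v*q≡ : v * q ≡ 1 + (Y ∸ z * q) * p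
  v*q≡ = ℕₚ.+-cancelʳ-≡ (z * q * p) _ _ (begin
    v * q + z * q * p                      ≡⟨ split ⟩
    1 + Y * p                              ≡⟨ cong (λ y → 1 + y * p) (ℕₚ.m∸n+n≡m zq≤Y) ⟨
    1 + (Y ∸ z * q + z * q) * p            ≡⟨ cong suc (ℕₚ.*-distribʳ-+ p (Y ∸ z * q) (z * q)) ⟩
    1 + (Y ∸ z * q) * p + z * q * p        ∎)
    where open ≡-Reasoning
  1≤v : ∀ v {x} → v * q ≡ suc x → 1 ≤ v
  1≤v (suc v) _ = s≤s z≤n

modular-inverse : ∀ {p q} → 1 < p → Coprime q p → ModularInverse p q
modular-inverse {p@(suc (suc p′))} {q} 1<p@(s≤s (s≤s _)) q⊥p with coprime-Bézout q⊥p
... | Bézout.+- x y e = reduce-inverse x y 1<p (sym e)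
-- Here x q ≡ -1 (mod p), so (p - 1) x is an inverse of q; `suc p′` is p - 1.
... | Bézout.-+ x (suc y) e = reduce-inverse (suc p′ * x) (y + p′ * suc y) 1<p
  (ℕₚ.+-cancelʳ-≡ (suc p′) _ _ (begin
    suc p′ * x * q + suc p′                ≡⟨ lemma p′ x q ⟩
    suc p′ * (1 + x * q)                   ≡⟨ cong (suc p′ *_) e ⟩
    suc p′ * (suc y * p)                   ≡⟨ lemma′ p′ y ⟩
    1 + (y + p′ * suc y) * p + suc p′      ∎))
  where
  open ≡-Reasoning
  lemma : ∀ a x q → suc a * x * q + suc a ≡ suc a * (1 + x * q)
  lemma = ℕSolver.solve-∀
  lemma′ : ∀ a y → suc a * (suc y * (2 + a)) ≡ 1 + (y + a * suc y) * (2 + a) + suc a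
  lemma′ = ℕSolver.solve-∀

-- The multiples of q in a run of p - 1 exponents

module _ {n q r : ℕ} (pp : Prime (3 + n)) (p∤r : ¬ 3 + n ∣ r) (q<r : q < r) {c u v s k : ℕ}
         (rep : ∀ m → m < 2 + n →
                ∃[ i ] ∃[ j ] (i < u) × (j < v) × (k ≡ (s + m) * r + (c + (i * (3 + n) + j * q))))
         where

  private
    w = 2 + n
    p = 3 + n

    -- The exponent at step m is c + I p + J q. The offset c lets one argument serve both signs: c =
    -- 0 for coefficient 1 and c = 1 for coefficient -1.
    I J : ∀ m → m < w → ℕ
    I m m<w = proj₁ (rep m m<w)
    J m m<w = proj₁ (proj₂ (rep m m<w))
    I< : ∀ m m<w → I m m<w < u
    I< m m<w = proj₁ (proj₂ (proj₂ (rep m m<w)))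
    J< : ∀ m m<w → J m m<w < v
    J< m m<w = proj₁ (proj₂ (proj₂ (proj₂ (rep m m<w))))
    k≡ : ∀ m m<w → k ≡ (s + m) * r + (c + (I m m<w * p + J m m<w * q))
    k≡ m m<w = proj₂ (proj₂ (proj₂ (proj₂ (rep m m<w))))

    difference : ∀ m d (a : m < w) (b : m + d < w) →
                 I m a * p + J m a * q ≡ d * r + (I (m + d) b * p + J (m + d) b * q)
    difference m d a b = ℕₚ.+-cancelˡ-≡ ((s + m) * r + c) _ _ (begin
      (s + m) * r + c + x                        ≡⟨ ℕₚ.+-assoc ((s + m) * r) c x ⟩
      (s + m) * r + (c + x)                      ≡⟨ trans (sym (k≡ m a)) (k≡ (m + d) b) ⟩
      (s + (m + d)) * r + (c + y)                ≡⟨ lemma s m d r c y ⟩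
      (s + m) * r + c + (d * r + y)              ∎)
      where
      open ≡-Reasoning
      x = I m a * p + J m a * q
      y = I (m + d) b * p + J (m + d) b * q
      lemma : ∀ s m d r c y → (s + (m + d)) * r + (c + y) ≡ (s + m) * r + c + (d * r + y)
      lemma = ℕSolver.solve-∀

    -- If j agrees at two steps a distance d apart, their exponents differ by d r and also by a
    -- multiple of p. So p ∣ d r, although 0 < d < p and p does not divide r.
    J-injective : ∀ m m′ (a : m < w) (b : m′ < w) → m < m′ → J m a ≢ J m′ b
    J-injective m m′ a b m<m′ Jm≡Jm′ with ℕₚ.m≤n⇒∃[o]m+o≡n m<m′
    ... | d , refl = go b Jm≡Jm′ (ℕₚ.+-suc m d)
      where
      go : ∀ {m′} (b : m′ < w) → J m a ≡ J m′ b → m + suc d ≡ m′ → ⊥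
      go b Jm≡Jm′ refl with euclidsLemma (suc d) r pp p∣dr
        where
        Ip≡ : I (m + suc d) b * p + suc d * r ≡ I m a * p
        Ip≡ = ℕₚ.+-cancelʳ-≡ (J m a * q) _ _ (sym (begin
          I m a * p + J m a * q        ≡⟨ difference m (suc d) a b ⟩
          suc d * r + (x + J (m + suc d) b * q)     ≡⟨ cong (λ j → suc d * r + (x + j * q)) Jm≡Jm′ ⟨
          suc d * r + (x + J m a * q)   ≡⟨ lemma (suc d * r) x (J m a * q) ⟩
          x + suc d * r + J m a * q     ∎))
          where
          open ≡-Reasoning
          x = I (m + suc d) b * p
          lemma : ∀ a b c → a + (b + c) ≡ b + a + c
          lemma = ℕSolver.solve-∀
        p∣dr : p ∣ suc d * r
        p∣dr = ∣m+n∣m⇒∣n (subst (p ∣_) (sym Ip≡) (n∣m*n (I m a))) (n∣m*n (I (m + suc d) b))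
      ... | inj₁ p∣d = ℕₚ.<⇒≱ (ℕₚ.≤-<-trans (ℕₚ.m≤n+m (suc d) m) (ℕₚ.<-trans b (ℕₚ.n<1+n w))) (∣⇒≤ p∣d)
      ... | inj₂ p∣r = p∤r p∣r

    w≤v : w ≤ v
    w≤v = ℕₚ.≮⇒≥ λ v<w →
      let f : Fin w → Fin v
          f x = fromℕ< (J< (toℕ x) (Finₚ.toℕ<n x))
          x , y , x<y , fx≡fy = Finₚ.pigeonhole v<w f
      in J-injective (toℕ x) (toℕ y) (Finₚ.toℕ<n x) (Finₚ.toℕ<n y) x<y
           (trans (sym (Finₚ.toℕ-fromℕ< _)) (trans (cong toℕ fx≡fy) (Finₚ.toℕ-fromℕ< _)))

  -- The residues of the exponents fill all v = p - 1 admissible classes, and since r > q the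
  -- multiples of q occurring in them decrease strictly, hence by exactly one at each step.
  full-run : v ≤ w → (v ≡ w → c + u * p ≤ 1 + q) →
             v ≡ w × (∃[ i ] ∃[ i′ ] i * p + q ≡ i′ * p + r)
  full-run v≤w small = v≡w , I 0 0<w , I 1 1<w , ℕₚ.+-cancelʳ-≡ (J 1 1<w * q) _ _ (begin-equality
      I 0 0<w * p + q + J 1 1<w * q          ≡⟨ ℕₚ.+-assoc (I 0 0<w * p) q _ ⟩
      I 0 0<w * p + suc (J 1 1<w) * q        ≡⟨ cong (λ j → I 0 0<w * p + j * q) J₀≡1+J₁ ⟨
      I 0 0<w * p + J 0 0<w * q              ≡⟨ difference 0 1 0<w 1<w ⟩
      1 * r + (I 1 1<w * p + J 1 1<w * q)    ≡⟨ lemma r (I 1 1<w * p) (J 1 1<w * q) ⟩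
      I 1 1<w * p + r + J 1 1<w * q          ∎)
    where
    open ℕₚ.≤-Reasoning
    lemma : ∀ a b c → 1 * a + (b + c) ≡ b + a + c
    lemma = ℕSolver.solve-∀
    v≡w : v ≡ w
    v≡w = ℕₚ.≤-antisym v≤w w≤v
    0<w : 0 < w
    0<w = s≤s z≤n
    1<w : 1 < w
    1<w = s≤s (s≤s z≤n)
    -- From i < u follows c + i p + p ≤ c + u p ≤ 1 + q, and p is at least 2.
    c+Ip<q : ∀ m m<w → c + I m m<w * p < q
    c+Ip<q m m<w = ℕ.s≤s⁻¹ (ℕₚ.≤-trans step (small v≡w))
      where
      i = I m m<w
      step : suc (suc (c + i * p)) ≤ c + u * p
      step = ℕₚ.≤-trans
        (subst (suc (suc (c + i * p)) ≤_) (eq c (i * p) n) (ℕₚ.+-monoʳ-≤ 2 (ℕₚ.m≤n+m (c + i * p) (suc n))))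
        (ℕₚ.+-monoʳ-≤ c (ℕₚ.*-monoˡ-≤ p (I< m m<w)))
        where
        eq : ∀ c x n → 2 + (suc n + (c + x)) ≡ c + (3 + n + x)
        eq = ℕSolver.solve-∀
    -- The exponent drops by r > q at each step. With j not decreasing, the part c + i p would have
    -- to absorb the drop, but it is below q.
    J-decreasing : ∀ m (a : m < w) (b : m + 1 < w) → J (m + 1) b < J m a
    J-decreasing m a b = ℕₚ.≰⇒> λ Jm≤J → ℕₚ.<-irrefl refl (begin-strict
      c + (I m a * p + J m a * q)                             ≡⟨ ℕₚ.+-assoc c _ _ ⟨
      c + I m a * p + J m a * q                               <⟨ ℕₚ.+-monoˡ-< (J m a * q) (c+Ip<q m a) ⟩
      q + J m a * q                                           ≤⟨ ℕₚ.+-mono-≤ (ℕₚ.<⇒≤ q<r) (ℕₚ.*-monoˡ-≤ q Jm≤J) ⟩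
      r + J (m + 1) b * q                                     ≤⟨ ℕₚ.m≤n+m _ (c + I (m + 1) b * p) ⟩
      c + I (m + 1) b * p + (r + J (m + 1) b * q)             ≡⟨ rearrange c (I (m + 1) b * p) r (J (m + 1) b * q) ⟩
      c + (1 * r + (I (m + 1) b * p + J (m + 1) b * q))       ≡⟨ cong (_+_ c) (difference m 1 a b) ⟨
      c + (I m a * p + J m a * q)                             ∎)
      where
      rearrange : ∀ c x r y → c + x + (r + y) ≡ c + (1 * r + (x + y))
      rearrange = ℕSolver.solve-∀
    J-lower : ∀ d m (a : m < w) → m + suc d ≡ w → d ≤ J m a
    J-lower zero    m a e = z≤n
    J-lower (suc d) m a e = ℕₚ.≤-<-trans (J-lower d (m + 1) b e′) (J-decreasing m a b)
      where
      e′ : m + 1 + suc d ≡ w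
      e′ = trans (ℕₚ.+-assoc m 1 (suc d)) e
      b : m + 1 < w
      b = subst (m + 1 <_) e′ (ℕₚ.m<m+n (m + 1) (s≤s z≤n))
    -- The range gives J 0 ≤ n + 1, and J 1 ≥ n because n strict drops follow it; there is no room
    -- for a drop by more than one.
    J₀≡1+J₁ : J 0 0<w ≡ suc (J 1 1<w)
    J₀≡1+J₁ = ℕₚ.≤-antisym
      (ℕₚ.≤-trans (ℕ.s≤s⁻¹ (subst (J 0 0<w <_) v≡w (J< 0 0<w))) (s≤s (J-lower n 1 1<w refl)))
      (J-decreasing 0 0<w 1<w)

-- The degree bound n ≤ (p - 1)(q - 1), free of subtraction. It is attained at i = u - 1, j = v - 1,
-- since u p + v q = 1 + p q.
exponent-bound : ∀ {p q u v t w n ε} → u + t ≡ q → v + w ≡ p → v * q ≡ 1 + t * p →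
                 Exponent p q u v t w n ε → n + (p + q) ≤ 1 + p * q
exponent-bound {p} {q} {u} {v} {t} {w} u+t≡q v+w≡p vq≡1+tp = λ where
    (pos {i} {j} i<u j<v refl) → begin
      i * p + j * q + (p + q)          ≡⟨ lemma i p j q ⟩
      suc i * p + suc j * q            ≤⟨ ℕₚ.+-mono-≤ (ℕₚ.*-monoˡ-≤ p i<u) (ℕₚ.*-monoˡ-≤ q j<v) ⟩
      u * p + v * q                    ≡⟨ trans (cong (_+_ (u * p)) vq≡1+tp) (ℕₚ.+-suc (u * p) (t * p)) ⟩
      1 + (u * p + t * p)              ≡⟨ cong suc (trans (sym (ℕₚ.*-distribʳ-+ p u t)) (trans (cong (_* p) u+t≡q) (ℕₚ.*-comm q p))) ⟩
      1 + p * q                        ∎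
    (neg {i} {j} i<t j<w refl) → begin
      1 + (i * p + j * q) + (p + q)    ≡⟨ cong suc (lemma i p j q) ⟩
      1 + (suc i * p + suc j * q)      ≤⟨ ℕₚ.+-monoʳ-≤ 1 (ℕₚ.+-mono-≤ (ℕₚ.*-monoˡ-≤ p i<t) (ℕₚ.*-monoˡ-≤ q j<w)) ⟩
      1 + t * p + w * q                ≡⟨ cong (_+ w * q) vq≡1+tp ⟨
      v * q + w * q                    ≡⟨ trans (sym (ℕₚ.*-distribʳ-+ q v w)) (cong (_* q) v+w≡p) ⟩
      p * q                            ≤⟨ ℕₚ.n≤1+n (p * q) ⟩
      1 + p * q                        ∎
  where
  open ℕₚ.≤-Reasoning
  lemma : ∀ i p j q → i * p + j * q + (p + q) ≡ suc i * p + suc j * q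
  lemma = ℕSolver.solve-∀

≤-from-bound : ∀ n w q′ → n + (suc w + suc q′) ≤ 1 + suc w * suc q′ → n ≤ w * q′
≤-from-bound n w q′ n≤ = ℕₚ.+-cancelʳ-≤ (suc w + suc q′) n (w * q′)
  (ℕₚ.≤-trans n≤ (ℕₚ.≤-reflexive (lemma w q′)))
  where
  lemma : ∀ w q → 1 + suc w * suc q ≡ w * q + (suc w + suc q)
  lemma = ℕSolver.solve-∀

prime∤< : ∀ {r m} → m < r → 0 < m → ¬ r ∣ m
prime∤< m<r 0<m r∣m = ℕₚ.<⇒≱ m<r (∣⇒≤ {{ℕ.>-nonZero 0<m}} r∣m)

-- The remainder n = k - l r lies in [0, (a + 1) r), which leaves only the a + 1 values of l ending
-- at k / r. When k / r < a, truncated subtraction starts the window at 0 and it still covers them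
-- all.
quotient-window : ∀ r .{{_ : NonZero r}} k l a n → k ≡ l * r + n → n < suc a * r →
                  (k / r ∸ a ≤ l) × (l < (k / r ∸ a) + suc a)
quotient-window r k l a n refl n<
  = ℕₚ.m≤n+o⇒m∸n≤o (k / r) a (ℕₚ.≤-trans (ℕ.s≤s⁻¹ k/r<) (ℕₚ.≤-reflexive (ℕₚ.+-comm l a)))
  , ℕₚ.≤-<-trans l≤k/r (ℕₚ.≤-<-trans (ℕₚ.m≤n+m∸n (k / r) a)
      (subst (a + (k / r ∸ a) <_) (ℕₚ.+-comm (suc a) (k / r ∸ a)) (ℕₚ.n<1+n _)))
  where
  k/r< : k / r < suc (l + a)
  k/r< = subst (k / r <_) (ℕₚ.+-suc l a) (m<n*o⇒m/o<n
    (subst (l * r + n <_) (sym (ℕₚ.*-distribʳ-+ r l (suc a))) (ℕₚ.+-monoʳ-< (l * r) n<)))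
  l≤k/r : l ≤ k / r
  l≤k/r = subst (_≤ k / r) (m*n/n≡m l r) (/-monoˡ-≤ r (ℕₚ.m≤m+n (l * r) n))

∣-transfer : ∀ {p x y} i i′ → i * p + x ≡ i′ * p + y → p ∣ x → p ∣ y
∣-transfer {p} i i′ e p∣x = ∣m+n∣m⇒∣n (subst (p ∣_) e (∣m∣n⇒∣m+n (n∣m*n i) p∣x)) (n∣m*n i′)

coeff-binary-trit : ∀ {p q u v t w n i} → i ≡ 0ℤ ⊎ Exponent p q u v t w n i → Trit i
coeff-binary-trit (inj₁ refl)        = 0ᵗ
coeff-binary-trit (inj₂ (pos _ _ _)) = 1ᵗ
coeff-binary-trit (inj₂ (neg _ _ _)) = -ᵗ

shift-trit : ∀ n f → (∀ m → Trit (coeff f m)) → ∀ k → Trit (coeff (X^ n *ₚ f) k)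
shift-trit n f f-trit k with coeff-X^* n f k
... | inj₁ e           = subst Trit (sym e) 0ᵗ
... | inj₂ (m , _ , e) = subst Trit (sym e) (f-trit m)

-- From a run to the congruences and the inequality, with `suc q` in the role of q

module _ {n q r : ℕ} (pp : Prime (3 + n)) (pr : Prime r) (p<q : 3 + n < suc q) (q<r : suc q < r)
         {a b t d : ℕ} (a+t≡q : a + t ≡ suc q) (b+d≡p : b + d ≡ 3 + n)
         (bq≡1+tp : b * suc q ≡ 1 + t * (3 + n)) (1≤b : 1 ≤ b) (1≤d : 1 ≤ d) {s k : ℕ} {ε : ℤ}
         (run : ∀ m → m < 2 + n → ∃[ x ] (k ≡ (s + m) * r + x) × Exponent (3 + n) (suc q) a b t d x ε)
         where

  private
    w = 2 + n
    p = 3 + n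

    p∤r : ¬ p ∣ r
    p∤r p∣r = prime∤* pp pr (ℕₚ.<⇒≢ (ℕₚ.<-trans p<q q<r)) (prime∤1 pp) (∣m⇒∣m*n 1 p∣r)

    -- What a p + b q = 1 + p q leaves for b = p - 1. It yields both p ∣ q + 1 and the size
    -- condition of `full-run`; `q≡tp` does the same for the other sign.
    ap≡1+q : b ≡ w → a * p ≡ 2 + q
    ap≡1+q refl = ℕₚ.+-cancelʳ-≡ (b * suc q) _ _ (begin
      a * p + b * suc q              ≡⟨ cong (_+_ (a * p)) bq≡1+tp ⟩
      a * p + (1 + t * p)            ≡⟨ lemma a t p ⟩
      1 + (a + t) * p                ≡⟨ cong (λ x → 1 + x * p) a+t≡q ⟩
      1 + suc q * p                  ≡⟨ lemma′ q w ⟩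
      2 + q + b * suc q              ∎)
      where
      open ≡-Reasoning
      lemma : ∀ a t p → a * p + (1 + t * p) ≡ 1 + (a + t) * p
      lemma = ℕSolver.solve-∀
      lemma′ : ∀ q w → 1 + suc q * suc w ≡ 2 + q + w * suc q
      lemma′ = ℕSolver.solve-∀

    q≡tp : d ≡ w → q ≡ t * p
    q≡tp refl = ℕₚ.suc-injective (trans (sym (ℕₚ.*-identityˡ (suc q)))
      (trans (cong (_* suc q) (sym (ℕₚ.+-cancelʳ-≡ d b 1 b+d≡p))) bq≡1+tp))

    b≤w : b ≤ w
    b≤w = ℕ.s≤s⁻¹ (subst (suc b ≤_) b+d≡p (ℕₚ.≤-trans (ℕₚ.≤-reflexive (ℕₚ.+-comm 1 b)) (ℕₚ.+-monoʳ-≤ b 1≤d)))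

    d≤w : d ≤ w
    d≤w = ℕ.s≤s⁻¹ (subst (suc d ≤_) b+d≡p (ℕₚ.+-monoˡ-≤ d 1≤b))

    Goal : Set
    Goal = ((p ∣ q) × (p ∣ r ∸ 1)) ⊎ ((p ∣ suc q + 1) × (p ∣ r + 1))

    pos-run : (∀ m → m < w → ∃[ x ] (k ≡ (s + m) * r + x) × Exponent p (suc q) a b t d x 1ℤ) → Goal
    pos-run run with full-run {q = suc q} pp p∤r q<r {c = 0} {s = s} rep b≤w (λ b≡w → ℕₚ.≤-reflexive (ap≡1+q b≡w))
      where
      rep : ∀ m → m < w → ∃[ i ] ∃[ j ] (i < a) × (j < b) × (k ≡ (s + m) * r + (0 + (i * p + j * suc q)))
      rep m m<w with run m m<w
      ... | _ , k≡ , pos {i} {j} i<a j<b refl = i , j , i<a , j<b , k≡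
    ... | b≡w , i , i′ , e = inj₂ (p∣q+1 , ∣-transfer i i′
            (trans (sym (ℕₚ.+-assoc (i * p) (suc q) 1)) (trans (cong (_+ 1) e) (ℕₚ.+-assoc (i′ * p) r 1))) p∣q+1)
      where
      p∣q+1 : p ∣ suc q + 1
      p∣q+1 = divides a (trans (ℕₚ.+-comm (suc q) 1) (sym (ap≡1+q b≡w)))

    neg-run : (∀ m → m < w → ∃[ x ] (k ≡ (s + m) * r + x) × Exponent p (suc q) a b t d x -1ℤ) → Goal
    neg-run run with full-run {q = suc q} pp p∤r q<r {c = 1} {s = s} rep d≤w
                       (λ d≡w → ℕₚ.≤-trans (ℕₚ.≤-reflexive (cong suc (sym (q≡tp d≡w)))) (ℕₚ.n≤1+n (suc q)))
      where
      rep : ∀ m → m < w → ∃[ i ] ∃[ j ] (i < t) × (j < d) × (k ≡ (s + m) * r + (1 + (i * p + j * suc q)))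
      rep m m<w with run m m<w
      ... | _ , k≡ , neg {i} {j} i<t j<d refl = i , j , i<t , j<d , k≡
    ... | d≡w , i , i′ , e = inj₁ (divides t (q≡tp d≡w) , ∣-transfer i i′
            (ℕₚ.suc-injective (begin
              suc (i * p + q)              ≡⟨ ℕₚ.+-suc (i * p) q ⟨
              i * p + suc q                ≡⟨ e ⟩
              i′ * p + r                   ≡⟨ cong (_+_ (i′ * p)) (ℕₚ.m+[n∸m]≡n 1≤r) ⟨
              i′ * p + suc (r ∸ 1)         ≡⟨ ℕₚ.+-suc (i′ * p) (r ∸ 1) ⟩
              suc (i′ * p + (r ∸ 1))       ∎)) (divides t (q≡tp d≡w)))
      where
      open ≡-Reasoning
      1≤r : 1 ≤ r
      1≤r = ℕₚ.<⇒≤ (prime>1 pr)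

    -- The two ends of the run are (p - 2) r apart, within the degree (p - 1)(q - 1) of Φ_pq.
    run-length : r * suc n ≤ w * q
    run-length with run 0 (s≤s z≤n) | run (suc n) ℕₚ.≤-refl
    ... | x , k≡ , ex | y , k≡′ , _ = begin
      r * suc n          ≤⟨ ℕₚ.m≤m+n (r * suc n) y ⟩
      r * suc n + y      ≡⟨ ℕₚ.+-cancelˡ-≡ (s * r) _ _ (trans (lemma s n r y)
                              (trans (sym k≡′) (trans k≡ (cong (λ z → z * r + x) (ℕₚ.+-identityʳ s))))) ⟩
      x                  ≤⟨ ≤-from-bound x w q (exponent-bound a+t≡q b+d≡p bq≡1+tp ex) ⟩
      w * q              ∎
      where
      open ℕₚ.≤-Reasoning
      lemma : ∀ s n r y → s * r + (r * suc n + y) ≡ (s + suc n) * r + y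
      lemma = ℕSolver.solve-∀

  run⇒congruences : ((p ∣ q) × (p ∣ r ∸ 1)) ⊎ ((p ∣ suc q + 1) × (p ∣ r + 1))
  -- The constructor at the first step determines `ε`, and with it the family of all exponents of
  -- the run.
  run⇒congruences with run 0 (s≤s z≤n)
  ... | _ , _ , pos _ _ _ = pos-run run
  ... | _ , _ , neg _ _ _ = neg-run run

  -- Equality in `run-length` would make the prime r divide (p - 1)(q - 1), but both factors are
  -- positive and smaller than r.
  run⇒inequality : r * suc n < w * q
  run⇒inequality = ℕₚ.≤∧≢⇒< run-length λ e → case-r (euclidsLemma w q pr (subst (r ∣_) e (m∣m*n (suc n))))
    where
    w<q : w < q
    w<q = ℕ.s≤s⁻¹ p<q
    q<r′ : q < r
    q<r′ = ℕₚ.<-trans (ℕₚ.n<1+n q) q<r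
    case-r : ¬ ((r ∣ w) ⊎ (r ∣ q))
    case-r (inj₁ r∣w) = prime∤< (ℕₚ.<-trans w<q q<r′) (s≤s z≤n) r∣w
    case-r (inj₂ r∣q) = prime∤< q<r′ (ℕₚ.≤-<-trans z≤n w<q) r∣q

-- Φ_pq has the coefficient ε at the w exponents k - (s + m) r.
record Run (p q r w : ℕ) : Set where
  constructor mkRun
  field
    {a b t d s k} : ℕ
    {ε} : ℤ
    a+t≡q : a + t ≡ q
    b+d≡p : b + d ≡ p
    bq≡1+tp : b * q ≡ 1 + t * p
    1≤b : 1 ≤ b
    1≤d : 1 ≤ d
    run : ∀ m → m < w → ∃[ x ] (k ≡ (s + m) * r + x) × Exponent p q a b t d x ε

Run⇒congruences∧inequality : ∀ {p q r} → Prime p → Prime r → 2 < p → p < q → q < r → Run p q r (p ∸ 1) →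
  (((p ∣ q ∸ 1) × (p ∣ r ∸ 1)) ⊎ ((p ∣ q + 1) × (p ∣ r + 1))) × (r * (p ∸ 2) < (p ∸ 1) * (q ∸ 1))
Run⇒congruences∧inequality {suc (suc (suc n))} {suc q} pp pr (s≤s (s≤s (s≤s _))) p<q q<r
  (mkRun {a} {s = s} a+t≡q b+d≡p bq≡1+tp 1≤b 1≤d run) =
    run⇒congruences pp pr p<q q<r {a} a+t≡q b+d≡p bq≡1+tp 1≤b 1≤d {s} run
  , run⇒inequality pp pr p<q q<r {a} a+t≡q b+d≡p bq≡1+tp 1≤b 1≤d {s} run

-- From the height to a run

exponent-< : ∀ {p q r x} w → p ≡ 2 + w → 0 < q → q < r → x + (p + q) ≤ 1 + p * q → x < suc w * r
exponent-< {q = suc q} {x = x} w refl _ q<r x≤ = ℕₚ.≤-<-trans (≤-from-bound x (suc w) q x≤)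
  (ℕₚ.*-monoʳ-< (suc w) (ℕₚ.<-trans (ℕₚ.n<1+n q) q<r))

inverse-quotient-≤ : ∀ {p q b t d} .{{_ : NonZero p}} → b + d ≡ p → b * q ≡ 1 + t * p → t ≤ q
inverse-quotient-≤ {p} {q} {b} {t} {d} b+d≡p bq≡1+tp = ℕₚ.*-cancelʳ-≤ t q p (begin
  t * p          ≤⟨ ℕₚ.n≤1+n (t * p) ⟩
  1 + t * p      ≡⟨ bq≡1+tp ⟨
  b * q          ≤⟨ ℕₚ.*-monoˡ-≤ q (subst (b ≤_) b+d≡p (ℕₚ.m≤m+n b d)) ⟩
  p * q          ≡⟨ ℕₚ.*-comm p q ⟩
  q * p          ∎)
  where open ℕₚ.≤-Reasoning

module _ {p q r w : ℕ} (p≡2+w : p ≡ 2 + w) (q⊥p : Coprime q p) (p<q : p < q) (q<r : q < r)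
         {a b t d : ℕ} (a+t≡q : a + t ≡ q) (b+d≡p : b + d ≡ p) (bq≡1+tp : b * q ≡ 1 + t * p)
         (1≤b : 1 ≤ b) (1≤d : 1 ≤ d)
         where

  private
    A : Poly
    A = binary p q a b t d
    0<q : 0 < q
    0<q = ℕₚ.≤-<-trans z≤n p<q
    instance
      q≢0 : NonZero q
      q≢0 = ℕ.>-nonZero 0<q
      r≢0 : NonZero r
      r≢0 = ℕ.>-nonZero (ℕₚ.<-trans 0<q q<r)
    A-coeff : ∀ m → coeff A m ≡ 0ℤ ⊎ Exponent p q a b t d m (coeff A m)
    A-coeff = coeff-binary a b t d q⊥p (subst (a ≤_) a+t≡q (ℕₚ.m≤m+n a t)) (subst (t ≤_) a+t≡q (ℕₚ.m≤n+m t a))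

  extremal-coefficient⇒Run : ∀ k →
    ∣ ∑ p (λ l → coeff (X^ ((q + l) * r) *ₚ A) k ℤ.- coeff (X^ (l * r) *ₚ A) k) ∣ ≡ suc w →
    Run p q r (suc w)
  extremal-coefficient⇒Run k ∣∑∣≡ = mkRun {s = s} a+t≡q b+d≡p bq≡1+tp 1≤b 1≤d run
    where
    g : ℕ → ℤ
    g l = coeff (X^ (l * r) *ₚ A) k
    exponent : ∀ l → g l ≢ 0ℤ → ∃[ x ] (k ≡ l * r + x) × Exponent p q a b t d x (g l)
    exponent l gl≢0 with coeff-X^-≢0 (l * r) A k gl≢0
    ... | x , k≡ , e with A-coeff x
    ...   | inj₁ e₀ = contradiction (trans e e₀) gl≢0
    ...   | inj₂ ex = x , k≡ , subst (Exponent p q a b t d x) (sym e) ex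
    -- All exponents k - l r are below (p - 1) r, so the relevant l are among p - 1 consecutive
    -- values ending at k / r; here w = p - 2.
    s : ℕ
    s = k / r ∸ w
    g-supp : ∀ l → g l ≢ 0ℤ → s ≤ l × l < s + suc w
    g-supp l gl≢0 with exponent l gl≢0
    ... | x , k≡ , ex = quotient-window r k l w x k≡
      (exponent-< w p≡2+w 0<q q<r (exponent-bound {t = t} a+t≡q b+d≡p bq≡1+tp ex))
    extremal : ∃[ ε ] (∀ m → m < suc w → g (s + m) ≡ ε × ε ≢ 0ℤ)
    extremal = extremal-run p<q (suc w) s g
      (λ l → shift-trit (l * r) A (λ m → coeff-binary-trit (A-coeff m)) k) g-supp ∣∑∣≡
    run : ∀ m → m < suc w → ∃[ x ] (k ≡ (s + m) * r + x) × Exponent p q a b t d x (proj₁ extremal)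
    run m m<w with proj₂ extremal m m<w
    ... | g≡ε , ε≢0 with exponent (s + m) (subst (_≢ 0ℤ) (sym g≡ε) ε≢0)
    ...   | x , k≡ , ex = x , k≡ , subst (Exponent p q a b t d x) g≡ε ex

height⇒Run : ∀ {Φ} → IsCyclotomic Φ → ∀ {p q r} → Prime p → Prime q → Prime r → p < q → q < r →
  ∀ w → p ≡ 2 + w →
  ∀ {Ψ} → Ψ *ₚ Φ (p * q * r) ≈ₚ xpow-1 (p * q * r) → height Ψ ≡ suc w → Run p q r (suc w)
height⇒Run cyc {p} {q} {r} pp pq pr p<q q<r w p≡2+w {Ψ} ΨΦ height≡ =
  extremal-coefficient⇒Run p≡2+w q⊥p p<q q<r {q ∸ t} {v} {t} a+t≡q v+w≡p vq≡1+tp 1≤v 1≤w (proj₁ attained)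
    (trans (cong ∣_∣ (sym (trans (at Ψ≋ _) (coeff-inverse-ternary p q r A _)))) (trans (proj₂ attained) height≡))
  where
  q⊥p : Coprime q p
  q⊥p = prime⇒coprime pq {{prime⇒nonZero pp}} p<q
  open ModularInverse (modular-inverse {p} {q} (prime>1 pp) q⊥p) renaming (w to d)
  a+t≡q : (q ∸ t) + t ≡ q
  a+t≡q = ℕₚ.m∸n+n≡m {n = t} (inverse-quotient-≤ {b = v} {{prime⇒nonZero pp}} v+w≡p vq≡1+tp)
  A : Poly
  A = binary p q (q ∸ t) v t d
  attained : ∃[ k ] ∣ coeff Ψ k ∣ ≡ height Ψ
  attained = height-attained Ψ (λ h≡0 → ℕₚ.1+n≢0 (trans (sym height≡) h≡0))
  Ψ≋ : Ψ ≋ (geom r p *ₚ (E (q * r) *ₚ A))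
  Ψ≋ = inverse-ternary p q r {A} {Ψ} (ℕₚ.<⇒≤ (prime>1 pp)) (ℕₚ.<⇒≤ (prime>1 pq)) (ℕₚ.<⇒≤ (prime>1 pr))
    (binary*E*E p q (q ∸ t) v t d a+t≡q v+w≡p vq≡1+tp)
    (Ψ*EpEqEr cyc {Ψ = Ψ} pp pq pr (ℕₚ.<⇒≢ p<q) (ℕₚ.<⇒≢ (ℕₚ.<-trans p<q q<r)) (ℕₚ.<⇒≢ q<r) ΨΦ)

theorem3 : (Φ : ℕ → Poly) → IsCyclotomic Φ →
    (p q r : ℕ) → Prime p → Prime q → Prime r → 2 < p → p < q → q < r →
    (Ψ : Poly) → Ψ *ₚ Φ (p * q * r) ≈ₚ xpow-1 (p * q * r) →
    height Ψ ≡ p ∸ 1 →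
    (((p ∣ q ∸ 1) × (p ∣ r ∸ 1)) ⊎ ((p ∣ q + 1) × (p ∣ r + 1)))
    × (r * (p ∸ 2) < (p ∸ 1) * (q ∸ 1))
theorem3 Φ cyc p q r pp pq pr 2<p p<q q<r Ψ ΨΦ height≡ =
  Run⇒congruences∧inequality pp pr 2<p p<q q<r (subst (Run p q r) (sym p-1≡)
    (height⇒Run cyc pp pq pr p<q q<r (p ∸ 2) p≡ {Ψ} ΨΦ (trans height≡ p-1≡)))
  where
  p≡ : p ≡ 2 + (p ∸ 2)
  p≡ = sym (ℕₚ.m+[n∸m]≡n (ℕₚ.<⇒≤ 2<p))
  p-1≡ : p ∸ 1 ≡ suc (p ∸ 2)
  p-1≡ = cong (_∸ 1) p≡
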